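{- Let $d\ge2$, let $f$ be a polynomial in $X_1,\dots,X_{d-1}$ with integer coefficients and constant term $0$ (with a fixed order of multiplication of variables in each monomial), and let $c\in\mathbb{Z}$. For a finite ring $R$ let $V_{f,c}(R)=\{(x_1,\dots,x_d)\in R^d : x_d=f(x_1,\dots,x_{d-1})+c\}$ and let $C_R$ denote the $V_{f,c}$-Salem number of $R$. Suppose $R=R_1\times R_2$ is a nontrivial product decomposition of a finite ring $R$ (with $R_1,R_2$ nonzero rings). Then $$C_R=\max\left(C_{R_1}|V_{f,c}(R_2)|^{\frac12},\ C_{R_2}|V_{f,c}(R_1)|^{\frac12}\right).$$
   Context: Rings are unital with $1\neq 0$ and not necessarily commutative; a polynomial with integer coefficients is a $\mathbb{Z}$-linear combination of words in the variables, so that it defines a function $R^{d-1}\to R$. For a finite ring $R$, a set $S\subseteq R^d$ and a character $\psi$ of the additive group of $R^d$, put $\widehat{S}(\psi)=\frac{1}{|R|^d}\sum_{x\in S}\psi(x)$. The set $S$ is called $C$-Salem if $|\widehat{S}(\psi)|\le C\,|R|^{ -d}\,|S|^{1/2}$ for all nontrivial additive characters $\psi$ of $R^d$. The $V_{f,c}$-Salem number (or constant) of $R$ is the smallest $C$ such that $V_{f,c}(R)$ is $C$-Salem. -}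

module Defs where

open import Algebra.Bundles using (Ring)
open import Algebra.Morphism.Structures using (module RingMorphisms)
import Algebra.Construct.DirectProduct as DirectProduct
import Algebra.Definitions.RawMonoid as RawMonoidDefs
open import Data.Fin.Base using (Fin)
import Data.Fin.Properties as Fin
open import Data.Integer.Base as ℤ using (ℤ; 0ℤ; +_; -[1+_]; +≤+; +<+)
import Data.Integer.Properties as ℤ
open import Data.List.Base as List using (List; []; _∷_)
open import Data.Nat.Base as ℕ using (ℕ; zero; suc)
import Data.Nat.Properties as ℕ
open import Data.Product.Base using (∃; _×_; _,_)
open import Data.Rational as ℚ using (ℚ; mkℚ; 0ℚ; 1ℚ; ½; Positive; *≤*; toℚᵘ)
import Data.Rational.Properties as ℚ
open import Data.Rational.Solver using (module +-*-Solver)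
open +-*-Solver using (solve; _:=_; _:+_; _:*_; _:-_; :-_; con)
open import Data.Rational.Unnormalised.Base as ℚᵘ using (mkℚᵘ; *≡*)
import Data.Rational.Unnormalised.Properties as ℚᵘ
open import Data.Sum.Base using (inj₁; inj₂)
open import Data.Vec.Base as Vec using (Vec; []; _∷_)
open import Data.Vec.Relation.Binary.Pointwise.Inductive using ([]; _∷_)
import Data.Vec.Relation.Binary.Equality.Setoid as VecEquality
open import Function.Bundles using (Inverse)
open import Level using (Level; _⊔_) renaming (suc to lsuc)
open import Relation.Binary.Definitions using (Decidable)
open import Relation.Binary.PropositionalEquality using (_≡_; refl; sym; trans; cong; subst; setoid)
open import Relation.Nullary using (¬_; Dec; yes; no)
open import Relation.Nullary.Decidable using (map′)
open import Relation.Unary using (Pred)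

------------------------------------------------------------------------
-- Real numbers: Cauchy sequences of rationals

IsCauchy : (ℕ → ℚ) → Set
IsCauchy s = ∀ ε → 0ℚ ℚ.< ε →
  ∃ λ N → ∀ m n → N ℕ.≤ m → N ℕ.≤ n → ℚ.∣ s m ℚ.- s n ∣ ℚ.< ε

record ℝ : Set where
  constructor mkℝ
  field
    seq    : ℕ → ℚ
    cauchy : IsCauchy seq

open ℝ public

infix 4 _≈ᴿ_ _≤ᴿ_

-- Records rather than function types, so that x and y can be inferred.
record _≈ᴿ_ (x y : ℝ) : Set where
  constructor mk≈
  field
    close : ∀ ε → 0ℚ ℚ.< ε →
      ∃ λ N → ∀ n → N ℕ.≤ n → ℚ.∣ seq x n ℚ.- seq y n ∣ ℚ.< ε

record _≤ᴿ_ (x y : ℝ) : Set where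
  constructor mk≤
  field
    below : ∀ ε → 0ℚ ℚ.< ε →
      ∃ λ N → ∀ n → N ℕ.≤ n → seq x n ℚ.< seq y n ℚ.+ ε

open _≈ᴿ_ public
open _≤ᴿ_ public

-- The Cauchy proofs are abstract because no relation on ℝ depends on them and
-- unfolding them makes type checking very slow.
module CauchyLemmas where


  dist<⇒<+ : ∀ p q {ε} → ℚ.∣ p ℚ.- q ∣ ℚ.< ε → p ℚ.< q ℚ.+ ε
  dist<⇒<+ p q {ε} h = begin-strict
    p                       ≡⟨ solve 2 (λ p q → p := q :+ (p :- q)) refl p q ⟩
    q ℚ.+ (p ℚ.- q)         ≤⟨ ℚ.+-monoʳ-≤ q (p≤∣p∣ (p ℚ.- q)) ⟩
    q ℚ.+ ℚ.∣ p ℚ.- q ∣     <⟨ ℚ.+-monoʳ-< q h ⟩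
    q ℚ.+ ε                 ∎
    where
    open ℚ.≤-Reasoning
    p≤∣p∣ : ∀ r → r ℚ.≤ ℚ.∣ r ∣
    p≤∣p∣ r with ℚ.≤-total 0ℚ r
    ... | inj₁ 0≤r = ℚ.≤-reflexive (sym (ℚ.0≤p⇒∣p∣≡p 0≤r))
    ... | inj₂ r≤0 = ℚ.≤-trans r≤0 (ℚ.0≤∣p∣ r)

  <+⇒dist< : ∀ p q {ε} → p ℚ.< q ℚ.+ ε → q ℚ.< p ℚ.+ ε → ℚ.∣ p ℚ.- q ∣ ℚ.< ε
  <+⇒dist< p q {ε} h k with ℚ.∣p∣≡p∨∣p∣≡-p (p ℚ.- q)
  ... | inj₁ eq = begin-strict
    ℚ.∣ p ℚ.- q ∣           ≡⟨ eq ⟩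
    p ℚ.- q                 <⟨ ℚ.+-monoˡ-< (ℚ.- q) h ⟩
    (q ℚ.+ ε) ℚ.- q         ≡⟨ solve 2 (λ q e → (q :+ e) :- q := e) refl q ε ⟩
    ε                       ∎
    where open ℚ.≤-Reasoning
  ... | inj₂ eq = begin-strict
    ℚ.∣ p ℚ.- q ∣           ≡⟨ eq ⟩
    ℚ.- (p ℚ.- q)           ≡⟨ solve 2 (λ p q → :- (p :- q) := q :- p) refl p q ⟩
    q ℚ.- p                 <⟨ ℚ.+-monoˡ-< (ℚ.- p) k ⟩
    (p ℚ.+ ε) ℚ.- p         ≡⟨ solve 2 (λ q e → (q :+ e) :- q := e) refl p ε ⟩
    ε                       ∎
    where open ℚ.≤-Reasoning

  dist-sym : ∀ p q → ℚ.∣ p ℚ.- q ∣ ≡ ℚ.∣ q ℚ.- p ∣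
  dist-sym p q = trans (sym (ℚ.∣-p∣≡∣p∣ (p ℚ.- q)))
    (cong ℚ.∣_∣ (solve 2 (λ p q → :- (p :- q) := q :- p) refl p q))

  *-pos : ∀ {p q} → 0ℚ ℚ.< p → 0ℚ ℚ.< q → 0ℚ ℚ.< p ℚ.* q
  *-pos {p} {q} 0<p 0<q =
    ℚ.positive⁻¹ (p ℚ.* q) {{ℚ.pos*pos⇒pos p {{ℚ.positive 0<p}} q {{ℚ.positive 0<q}}}}

  half : ℚ → ℚ
  half ε = ½ ℚ.* ε

  half-pos : ∀ {ε} → 0ℚ ℚ.< ε → 0ℚ ℚ.< half ε
  half-pos = *-pos (ℚ.positive⁻¹ ½)

  half+half : ∀ ε → half ε ℚ.+ half ε ≡ ε
  half+half = solve 1 (λ e → con ½ :* e :+ con ½ :* e := e) refl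

  module _ {s t : ℕ → ℚ} (cs : IsCauchy s) (ct : IsCauchy t) where

    abstract
      +-cauchy : IsCauchy (λ n → s n ℚ.+ t n)
      +-cauchy ε 0<ε =
        let N₁ , h₁ = cs (half ε) (half-pos 0<ε)
            N₂ , h₂ = ct (half ε) (half-pos 0<ε)
        in N₁ ℕ.⊔ N₂ , λ m n N≤m N≤n → begin-strict
             ℚ.∣ (s m ℚ.+ t m) ℚ.- (s n ℚ.+ t n) ∣
               ≡⟨ cong ℚ.∣_∣ (solve 4 (λ a b c d → (a :+ b) :- (c :+ d) := (a :- c) :+ (b :- d)) refl (s m) (t m) (s n) (t n)) ⟩
             ℚ.∣ (s m ℚ.- s n) ℚ.+ (t m ℚ.- t n) ∣
               ≤⟨ ℚ.∣p+q∣≤∣p∣+∣q∣ (s m ℚ.- s n) (t m ℚ.- t n) ⟩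
             ℚ.∣ s m ℚ.- s n ∣ ℚ.+ ℚ.∣ t m ℚ.- t n ∣
               <⟨ ℚ.+-mono-< (h₁ m n (ℕ.m⊔n≤o⇒m≤o N₁ N₂ N≤m) (ℕ.m⊔n≤o⇒m≤o N₁ N₂ N≤n))
                             (h₂ m n (ℕ.m⊔n≤o⇒n≤o N₁ N₂ N≤m) (ℕ.m⊔n≤o⇒n≤o N₁ N₂ N≤n)) ⟩
             half ε ℚ.+ half ε
               ≡⟨ half+half ε ⟩
             ε ∎
        where open ℚ.≤-Reasoning

    abstract
      ⊔-cauchy : IsCauchy (λ n → s n ℚ.⊔ t n)
      ⊔-cauchy ε 0<ε =
        let N₁ , h₁ = cs ε 0<ε
            N₂ , h₂ = ct ε 0<ε
            below : ∀ m n → N₁ ℕ.⊔ N₂ ℕ.≤ m → N₁ ℕ.⊔ N₂ ℕ.≤ n → s m ℚ.⊔ t m ℚ.< (s n ℚ.⊔ t n) ℚ.+ ε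
            below m n N≤m N≤n = ⊔-lub-<
              (ℚ.<-≤-trans (dist<⇒<+ (s m) (s n) (h₁ m n (ℕ.m⊔n≤o⇒m≤o N₁ N₂ N≤m) (ℕ.m⊔n≤o⇒m≤o N₁ N₂ N≤n)))
                           (ℚ.+-monoˡ-≤ ε (ℚ.p≤p⊔q (s n) (t n))))
              (ℚ.<-≤-trans (dist<⇒<+ (t m) (t n) (h₂ m n (ℕ.m⊔n≤o⇒n≤o N₁ N₂ N≤m) (ℕ.m⊔n≤o⇒n≤o N₁ N₂ N≤n)))
                           (ℚ.+-monoˡ-≤ ε (ℚ.p≤q⊔p (s n) (t n))))
        in N₁ ℕ.⊔ N₂ , λ m n N≤m N≤n →
             <+⇒dist< (s m ℚ.⊔ t m) (s n ℚ.⊔ t n) (below m n N≤m N≤n) (below n m N≤n N≤m)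
        where
        ⊔-lub-< : ∀ {p q r} → p ℚ.< r → q ℚ.< r → p ℚ.⊔ q ℚ.< r
        ⊔-lub-< {p} {q} {r} p<r q<r with ℚ.≤-total p q
        ... | inj₁ p≤q = subst (ℚ._< r) (sym (ℚ.p≤q⇒p⊔q≡q p≤q)) q<r
        ... | inj₂ q≤p = subst (ℚ._< r) (sym (ℚ.p≥q⇒p⊔q≡p q≤p)) p<r

  abstract
    neg-cauchy : ∀ {s} → IsCauchy s → IsCauchy (λ n → ℚ.- s n)
    neg-cauchy {s} cs ε 0<ε =
      let N , h = cs ε 0<ε
      in N , λ m n N≤m N≤n → subst (ℚ._< ε)
           (trans (dist-sym (s m) (s n))
                  (cong ℚ.∣_∣ (solve 2 (λ p q → q :- p := (:- p) :- (:- q)) refl (s m) (s n))))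
           (h m n N≤m N≤n)

  abstract
    const-cauchy : ∀ q → IsCauchy (λ _ → q)
    const-cauchy q ε 0<ε = 0 , λ _ _ _ _ →
      subst (ℚ._< ε) (sym (cong ℚ.∣_∣ (ℚ.+-inverseʳ q))) 0<ε

  bounded : ∀ {s} → IsCauchy s →
    ∃ λ B → 0ℚ ℚ.< B × ∃ λ N → ∀ n → N ℕ.≤ n → ℚ.∣ s n ∣ ℚ.≤ B
  bounded {s} cs =
    let N , h = cs 1ℚ (ℚ.positive⁻¹ 1ℚ)
    in ℚ.∣ s N ∣ ℚ.+ 1ℚ
     , ℚ.+-mono-≤-< (ℚ.0≤∣p∣ (s N)) (ℚ.positive⁻¹ 1ℚ)
     , N , λ n N≤n → begin
         ℚ.∣ s n ∣                            ≡⟨ cong ℚ.∣_∣ (solve 2 (λ a b → a := b :+ (a :- b)) refl (s n) (s N)) ⟩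
         ℚ.∣ s N ℚ.+ (s n ℚ.- s N) ∣          ≤⟨ ℚ.∣p+q∣≤∣p∣+∣q∣ (s N) (s n ℚ.- s N) ⟩
         ℚ.∣ s N ∣ ℚ.+ ℚ.∣ s n ℚ.- s N ∣      ≤⟨ ℚ.+-monoʳ-≤ ℚ.∣ s N ∣ (ℚ.<⇒≤ (h n N N≤n ℕ.≤-refl)) ⟩
         ℚ.∣ s N ∣ ℚ.+ 1ℚ                     ∎
    where open ℚ.≤-Reasoning

  divide : ∀ {B ε} → 0ℚ ℚ.< B → 0ℚ ℚ.< ε → ∃ λ δ → 0ℚ ℚ.< δ × B ℚ.* δ ≡ ε
  divide {B} {ε} 0<B 0<ε =
    (ℚ.1/ B) ℚ.* ε
    , *-pos (ℚ.positive⁻¹ (ℚ.1/ B) {{ℚ.1/pos⇒pos B}}) 0<ε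
    , trans (sym (ℚ.*-assoc B (ℚ.1/ B) ε)) (trans (cong (ℚ._* ε) (ℚ.*-inverseʳ B)) (ℚ.*-identityˡ ε))
    where
    instance
      posB : Positive B
      posB = ℚ.positive 0<B
      nzB : ℚ.NonZero B
      nzB = ℚ.pos⇒nonZero B

  *-bound-< : ∀ p q {B δ} → 0ℚ ℚ.< B → ℚ.∣ p ∣ ℚ.≤ B → ℚ.∣ q ∣ ℚ.< δ → ℚ.∣ p ℚ.* q ∣ ℚ.< B ℚ.* δ
  *-bound-< p q {B} {δ} 0<B p≤B q<δ = begin-strict
    ℚ.∣ p ℚ.* q ∣          ≡⟨ ℚ.∣p*q∣≡∣p∣*∣q∣ p q ⟩
    ℚ.∣ p ∣ ℚ.* ℚ.∣ q ∣    ≤⟨ ℚ.*-monoʳ-≤-nonNeg ℚ.∣ q ∣ {{ℚ.∣-∣-nonNeg q}} p≤B ⟩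
    B ℚ.* ℚ.∣ q ∣          <⟨ ℚ.*-monoʳ-<-pos B {{ℚ.positive 0<B}} q<δ ⟩
    B ℚ.* δ                ∎
    where open ℚ.≤-Reasoning

  abstract
    *-cauchy : ∀ {s t} → IsCauchy s → IsCauchy t → IsCauchy (λ n → s n ℚ.* t n)
    *-cauchy {s} {t} cs ct ε 0<ε =
      let A , 0<A , M₁ , a = bounded cs
          B , 0<B , M₂ , b = bounded ct
          δ , 0<δ , Aδ = divide 0<A (half-pos 0<ε)
          η , 0<η , Bη = divide 0<B (half-pos 0<ε)
          N₁ , h₁ = cs η 0<η
          N₂ , h₂ = ct δ 0<δ
          N = (M₁ ℕ.⊔ M₂) ℕ.⊔ (N₁ ℕ.⊔ N₂)
          M₁≤ : ∀ {n} → N ℕ.≤ n → M₁ ℕ.≤ n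
          M₁≤ p = ℕ.m⊔n≤o⇒m≤o M₁ M₂ (ℕ.m⊔n≤o⇒m≤o (M₁ ℕ.⊔ M₂) (N₁ ℕ.⊔ N₂) p)
          M₂≤ : ∀ {n} → N ℕ.≤ n → M₂ ℕ.≤ n
          M₂≤ p = ℕ.m⊔n≤o⇒n≤o M₁ M₂ (ℕ.m⊔n≤o⇒m≤o (M₁ ℕ.⊔ M₂) (N₁ ℕ.⊔ N₂) p)
          N₁≤ : ∀ {n} → N ℕ.≤ n → N₁ ℕ.≤ n
          N₁≤ p = ℕ.m⊔n≤o⇒m≤o N₁ N₂ (ℕ.m⊔n≤o⇒n≤o (M₁ ℕ.⊔ M₂) (N₁ ℕ.⊔ N₂) p)
          N₂≤ : ∀ {n} → N ℕ.≤ n → N₂ ℕ.≤ n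
          N₂≤ p = ℕ.m⊔n≤o⇒n≤o N₁ N₂ (ℕ.m⊔n≤o⇒n≤o (M₁ ℕ.⊔ M₂) (N₁ ℕ.⊔ N₂) p)
      in N , λ m n N≤m N≤n → begin-strict
           ℚ.∣ s m ℚ.* t m ℚ.- s n ℚ.* t n ∣
             ≡⟨ cong ℚ.∣_∣ (solve 4 (λ a b c d → a :* b :- c :* d := a :* (b :- d) :+ d :* (a :- c)) refl (s m) (t m) (s n) (t n)) ⟩
           ℚ.∣ s m ℚ.* (t m ℚ.- t n) ℚ.+ t n ℚ.* (s m ℚ.- s n) ∣
             ≤⟨ ℚ.∣p+q∣≤∣p∣+∣q∣ (s m ℚ.* (t m ℚ.- t n)) (t n ℚ.* (s m ℚ.- s n)) ⟩
           ℚ.∣ s m ℚ.* (t m ℚ.- t n) ∣ ℚ.+ ℚ.∣ t n ℚ.* (s m ℚ.- s n) ∣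
             <⟨ ℚ.+-mono-< (*-bound-< (s m) (t m ℚ.- t n) 0<A (a m (M₁≤ N≤m)) (h₂ m n (N₂≤ N≤m) (N₂≤ N≤n)))
                           (*-bound-< (t n) (s m ℚ.- s n) 0<B (b n (M₂≤ N≤n)) (h₁ m n (N₁≤ N≤m) (N₁≤ N≤n))) ⟩
           A ℚ.* δ ℚ.+ B ℚ.* η
             ≡⟨ trans (cong (ℚ._+ B ℚ.* η) Aδ) (cong (half ε ℚ.+_) Bη) ⟩
           half ε ℚ.+ half ε
             ≡⟨ half+half ε ⟩
           ε ∎
      where open ℚ.≤-Reasoning

open CauchyLemmas

infixl 6 _+ᴿ_ _-ᴿ_ _⊔ᴿ_
infixl 7 _*ᴿ_
infix  8 -ᴿ_

fromℚ : ℚ → ℝ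
fromℚ q = mkℝ (λ _ → q) (const-cauchy q)

fromℕ : ℕ → ℝ
fromℕ n = fromℚ (+ n ℚ./ 1)

0ᴿ 1ᴿ : ℝ
0ᴿ = fromℚ 0ℚ
1ᴿ = fromℚ 1ℚ

_+ᴿ_ : ℝ → ℝ → ℝ
x +ᴿ y = mkℝ (λ n → seq x n ℚ.+ seq y n) (+-cauchy {seq x} {seq y} (cauchy x) (cauchy y))

_*ᴿ_ : ℝ → ℝ → ℝ
x *ᴿ y = mkℝ (λ n → seq x n ℚ.* seq y n) (*-cauchy {seq x} {seq y} (cauchy x) (cauchy y))

_⊔ᴿ_ : ℝ → ℝ → ℝ
x ⊔ᴿ y = mkℝ (λ n → seq x n ℚ.⊔ seq y n) (⊔-cauchy {seq x} {seq y} (cauchy x) (cauchy y))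

-ᴿ_ : ℝ → ℝ
-ᴿ x = mkℝ (λ n → ℚ.- seq x n) (neg-cauchy {seq x} (cauchy x))

_-ᴿ_ : ℝ → ℝ → ℝ
x -ᴿ y = x +ᴿ (-ᴿ y)

------------------------------------------------------------------------
-- Square roots

-- grid k n = k / (n + 1)
grid : ℕ → ℕ → ℚ
grid k n = + k ℚ./ suc n

-- The largest element r of {0, 1/(n+1), …, K/(n+1)} with r² ≤ q
-- (or 0 if there is none).
searchRoot : (n : ℕ) → ℚ → (K : ℕ) → ℚ
searchRoot n q zero = 0ℚ
searchRoot n q (suc K) with grid (suc K) n ℚ.* grid (suc K) n ℚ.≤? q
... | yes _ = grid (suc K) n
... | no  _ = searchRoot n q K

-- For q ≥ 0, the largest multiple r of 1/(n+1) with r² ≤ q; the search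
-- bound corresponds to the rational |numerator of q|.
approxRoot : ℕ → ℚ → ℚ
approxRoot n q = searchRoot n q (ℤ.∣ ℚ.↥ q ∣ ℕ.* suc n)

module RootLemmas where

  grid-suc : ∀ k n → grid (suc k) n ≡ grid k n ℚ.+ grid 1 n
  grid-suc k n = ℚ.toℚᵘ-injective (begin
    toℚᵘ (grid (suc k) n)                      ≈⟨ ℚ.toℚᵘ-fromℚᵘ (mkℚᵘ (+ suc k) n) ⟩
    mkℚᵘ (+ suc k) n                           ≈⟨ *≡* (numerators k (suc n)) ⟩
    mkℚᵘ (+ k) n ℚᵘ.+ mkℚᵘ (+ 1) n             ≈⟨ ℚᵘ.+-cong (ℚ.toℚᵘ-fromℚᵘ (mkℚᵘ (+ k) n)) (ℚ.toℚᵘ-fromℚᵘ (mkℚᵘ (+ 1) n)) ⟨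
    toℚᵘ (grid k n) ℚᵘ.+ toℚᵘ (grid 1 n)       ≈⟨ ℚ.toℚᵘ-homo-+ (grid k n) (grid 1 n) ⟨
    toℚᵘ (grid k n ℚ.+ grid 1 n)               ∎)
    where
    open import Relation.Binary.Reasoning.Setoid ℚᵘ.≃-setoid
    open import Data.Integer.Tactic.RingSolver using (solve-∀)
    numerators : ∀ k d → + suc k ℤ.* + (d ℕ.* d) ≡ (+ k ℤ.* + d ℤ.+ + 1 ℤ.* + d) ℤ.* + d
    numerators k d = trans
      (cong (+ suc k ℤ.*_) (ℤ.pos-* d d))
      (lemma (+ k) (+ d))
      where
      lemma : ∀ a b → (+ 1 ℤ.+ a) ℤ.* (b ℤ.* b) ≡ (a ℤ.* b ℤ.+ + 1 ℤ.* b) ℤ.* b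
      lemma = solve-∀

  grid-≤ : ∀ k n (q : ℚ) → + k ℤ.* ℚ.↧ q ℤ.≤ ℚ.↥ q ℤ.* + suc n → grid k n ℚ.≤ q
  grid-≤ k n (mkℚ _ _ _) h = ℚ.toℚᵘ-cancel-≤
    (ℚᵘ.≤-respˡ-≃ (ℚᵘ.≃-sym (ℚ.toℚᵘ-fromℚᵘ (mkℚᵘ (+ k) n))) (ℚᵘ.*≤* h))

  ≤-grid : ∀ k n (q : ℚ) → ℚ.↥ q ℤ.* + suc n ℤ.≤ + k ℤ.* ℚ.↧ q → q ℚ.≤ grid k n
  ≤-grid k n (mkℚ _ _ _) h = ℚ.toℚᵘ-cancel-≤
    (ℚᵘ.≤-respʳ-≃ (ℚᵘ.≃-sym (ℚ.toℚᵘ-fromℚᵘ (mkℚᵘ (+ k) n))) (ℚᵘ.*≤* h))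

  grid-nonNeg : ∀ k n → 0ℚ ℚ.≤ grid k n
  grid-nonNeg k n = ℚ.nonNegative⁻¹ (grid k n) {{ℚ.normalize-nonNeg k (suc n)}}

  grid-pos : ∀ n → 0ℚ ℚ.< grid 1 n
  grid-pos n = ℚ.positive⁻¹ (grid 1 n) {{ℚ.normalize-pos 1 (suc n)}}

  archimedean : ∀ ε → 0ℚ ℚ.< ε → ∃ λ N → ∀ n → N ℕ.≤ n → grid 1 n ℚ.≤ ε
  archimedean ε@(mkℚ (+ suc a) b _) _ = b , λ n b≤n → grid-≤ 1 n ε
    (ℤ.≤-trans (ℤ.≤-reflexive (ℤ.*-identityˡ (+ suc b)))
      (ℤ.≤-trans (+≤+ (ℕ.≤-trans (ℕ.s≤s b≤n) (ℕ.m≤n*m (suc n) (suc a))))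
                 (ℤ.≤-reflexive (ℤ.pos-* (suc a) (suc n)))))
  archimedean (mkℚ (+ zero) b _) (ℚ.*<* (+<+ ()))
  archimedean (mkℚ (-[1+ _ ]) b _) (ℚ.*<* ())

  sq-mono-≤ : ∀ {p q} → 0ℚ ℚ.≤ p → p ℚ.≤ q → p ℚ.* p ℚ.≤ q ℚ.* q
  sq-mono-≤ {p} {q} 0≤p p≤q = ℚ.≤-trans
    (ℚ.*-monoʳ-≤-nonNeg p {{ℚ.nonNegative 0≤p}} p≤q)
    (ℚ.*-monoˡ-≤-nonNeg q {{ℚ.nonNegative (ℚ.≤-trans 0≤p p≤q)}} p≤q)

  searchRoot-nonNeg : ∀ n q K → 0ℚ ℚ.≤ searchRoot n q K
  searchRoot-nonNeg n q zero = ℚ.≤-refl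
  searchRoot-nonNeg n q (suc K) with grid (suc K) n ℚ.* grid (suc K) n ℚ.≤? q
  ... | yes _ = grid-nonNeg (suc K) n
  ... | no  _ = searchRoot-nonNeg n q K

  searchRoot-lower : ∀ n q K → 0ℚ ℚ.≤ q → searchRoot n q K ℚ.* searchRoot n q K ℚ.≤ q
  searchRoot-lower n q zero 0≤q = 0≤q
  searchRoot-lower n q (suc K) 0≤q with grid (suc K) n ℚ.* grid (suc K) n ℚ.≤? q
  ... | yes p = p
  ... | no  _ = searchRoot-lower n q K 0≤q

  sq : ℚ → ℚ
  sq p = p ℚ.* p

  searchRoot-upper : ∀ n q K → q ℚ.< sq (grid (suc K) n) →
                     q ℚ.< sq (searchRoot n q K ℚ.+ grid 1 n)
  searchRoot-upper n q zero h =
    subst (λ r → q ℚ.< sq r) (sym (ℚ.+-identityˡ (grid 1 n))) h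
  searchRoot-upper n q (suc K) h with grid (suc K) n ℚ.* grid (suc K) n ℚ.≤? q
  ... | yes _ = subst (λ r → q ℚ.< sq r) (grid-suc (suc K) n) h
  ... | no ¬p = searchRoot-upper n q K (ℚ.≰⇒> ¬p)

  search-bound : ∀ n q → 0ℚ ℚ.≤ q → q ℚ.< sq (grid (suc (ℤ.∣ ℚ.↥ q ∣ ℕ.* suc n)) n)
  search-bound n (mkℚ (-[1+ _ ]) _ _) (*≤* ())
  search-bound n q@(mkℚ (+ zero) d _) 0≤q = ℚ.≤-<-trans
    (≤-grid 0 n q (ℤ.≤-reflexive refl))
    (ℚ.≤-<-trans (ℚ.≤-reflexive (ℚ.0/n≡0 (suc n))) (*-pos (grid-pos n) (grid-pos n)))
  search-bound n q@(mkℚ (+ suc a) d _) 0≤q = begin-strict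
    q                    ≤⟨ ≤-grid K n q q≤g ⟩
    g                    ≡⟨ ℚ.*-identityʳ g ⟨
    g ℚ.* 1ℚ             ≤⟨ ℚ.*-monoˡ-≤-nonNeg g {{ℚ.nonNegative (grid-nonNeg K n)}} 1≤g ⟩
    g ℚ.* g              <⟨ ℚ.<-respʳ-≡ (solve 2 (λ g h → g :* g :+ (h :* (g :+ g) :+ h :* h) := (g :+ h) :* (g :+ h)) refl g h)
                              (ℚ.<-respˡ-≡ (ℚ.+-identityʳ (g ℚ.* g)) (ℚ.+-monoʳ-< (g ℚ.* g) increment)) ⟩
    sq (g ℚ.+ h)         ≡⟨ cong sq (grid-suc K n) ⟨
    sq (grid (suc K) n)  ∎
    where
    open ℚ.≤-Reasoning
    K = suc a ℕ.* suc n
    g = grid K n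
    h = grid 1 n
    q≤g : + suc a ℤ.* + suc n ℤ.≤ + K ℤ.* + suc d
    q≤g = ℤ.≤-trans (ℤ.≤-reflexive (sym (ℤ.pos-* (suc a) (suc n))))
      (ℤ.≤-trans (+≤+ (ℕ.m≤m*n K (suc d))) (ℤ.≤-reflexive (ℤ.pos-* K (suc d))))
    1≤g : 1ℚ ℚ.≤ g
    1≤g = ≤-grid K n 1ℚ (ℤ.≤-trans (ℤ.≤-reflexive (ℤ.*-identityˡ (+ suc n)))
      (ℤ.≤-trans (+≤+ (ℕ.m≤n*m (suc n) (suc a))) (ℤ.≤-reflexive (sym (ℤ.*-identityʳ (+ K))))))
    increment : 0ℚ ℚ.< h ℚ.* (g ℚ.+ g) ℚ.+ h ℚ.* h
    increment = ℚ.+-mono-≤-<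
      (ℚ.nonNegative⁻¹ (h ℚ.* (g ℚ.+ g)) {{ℚ.nonNeg*nonNeg⇒nonNeg h {{ℚ.nonNegative (grid-nonNeg 1 n)}} (g ℚ.+ g)
        {{ℚ.nonNegative (ℚ.+-mono-≤ (grid-nonNeg K n) (grid-nonNeg K n))}}}})
      (*-pos (grid-pos n) (grid-pos n))

open RootLemmas

approxRoot-nonNeg : ∀ n q → 0ℚ ℚ.≤ approxRoot n q
approxRoot-nonNeg n q = searchRoot-nonNeg n q (ℤ.∣ ℚ.↥ q ∣ ℕ.* suc n)

approxRoot-lower : ∀ n q → 0ℚ ℚ.≤ q → approxRoot n q ℚ.* approxRoot n q ℚ.≤ q
approxRoot-lower n q = searchRoot-lower n q (ℤ.∣ ℚ.↥ q ∣ ℕ.* suc n)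

approxRoot-upper : ∀ n q → 0ℚ ℚ.≤ q →
  q ℚ.< (approxRoot n q ℚ.+ grid 1 n) ℚ.* (approxRoot n q ℚ.+ grid 1 n)
approxRoot-upper n q 0≤q =
  searchRoot-upper n q (ℤ.∣ ℚ.↥ q ∣ ℕ.* suc n) (search-bound n q 0≤q)

module RootCauchy where

  root-close : ∀ m n {a b ε} → 0ℚ ℚ.≤ a → 0ℚ ℚ.≤ b → 0ℚ ℚ.< ε →
    a ℚ.< b ℚ.+ sq (half ε) → grid 1 n ℚ.≤ half ε →
    approxRoot m a ℚ.< approxRoot n b ℚ.+ ε
  root-close m n {a} {b} {ε} 0≤a 0≤b 0<ε a<b+ h≤ = ℚ.≰⇒> λ s≥ →
    ℚ.<-irrefl refl (begin-strict
      a                                  <⟨ a<b+ ⟩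
      b ℚ.+ sq e                         <⟨ ℚ.+-monoˡ-< (sq e) (approxRoot-upper n b 0≤b) ⟩
      sq (r ℚ.+ h) ℚ.+ sq e              ≤⟨ ℚ.+-monoˡ-≤ (sq e) (sq-mono-≤ 0≤r+h (ℚ.+-monoʳ-≤ r h≤)) ⟩
      sq (r ℚ.+ e) ℚ.+ sq e              ≡⟨ ℚ.+-identityʳ _ ⟨
      (sq (r ℚ.+ e) ℚ.+ sq e) ℚ.+ 0ℚ     ≤⟨ ℚ.+-monoʳ-≤ (sq (r ℚ.+ e) ℚ.+ sq e) cross ⟩
      (sq (r ℚ.+ e) ℚ.+ sq e) ℚ.+ (e ℚ.* (r ℚ.+ e) ℚ.+ e ℚ.* (r ℚ.+ e))
        ≡⟨ solve 2 (λ r e → ((r :+ e) :* (r :+ e) :+ e :* e) :+ (e :* (r :+ e) :+ e :* (r :+ e))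
                         := (r :+ (e :+ e)) :* (r :+ (e :+ e))) refl r e ⟩
      sq (r ℚ.+ (e ℚ.+ e))               ≡⟨ cong (λ z → sq (r ℚ.+ z)) (half+half ε) ⟩
      sq (r ℚ.+ ε)                       ≤⟨ sq-mono-≤ (ℚ.+-mono-≤ 0≤r (ℚ.<⇒≤ 0<ε)) s≥ ⟩
      sq (approxRoot m a)                ≤⟨ approxRoot-lower m a 0≤a ⟩
      a                                  ∎)
    where
    open ℚ.≤-Reasoning
    e = half ε
    h = grid 1 n
    r = approxRoot n b
    0≤e : 0ℚ ℚ.≤ e
    0≤e = ℚ.<⇒≤ (half-pos 0<ε)
    0≤r : 0ℚ ℚ.≤ r
    0≤r = approxRoot-nonNeg n b
    0≤r+h : 0ℚ ℚ.≤ r ℚ.+ h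
    0≤r+h = ℚ.+-mono-≤ 0≤r (grid-nonNeg 1 n)
    prod : 0ℚ ℚ.≤ e ℚ.* (r ℚ.+ e)
    prod = ℚ.nonNegative⁻¹ (e ℚ.* (r ℚ.+ e)) {{ℚ.nonNeg*nonNeg⇒nonNeg e {{ℚ.nonNegative 0≤e}} (r ℚ.+ e)
             {{ℚ.nonNegative (ℚ.+-mono-≤ 0≤r 0≤e)}}}}
    cross : 0ℚ ℚ.≤ e ℚ.* (r ℚ.+ e) ℚ.+ e ℚ.* (r ℚ.+ e)
    cross = ℚ.+-mono-≤ prod prod

  abstract
    root-cauchy : ∀ {s} → (∀ n → 0ℚ ℚ.≤ s n) → IsCauchy s → IsCauchy (λ n → approxRoot n (s n))
    root-cauchy {s} 0≤s cs ε 0<ε =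
      let N₁ , h₁ = cs (sq (half ε)) (*-pos (half-pos 0<ε) (half-pos 0<ε))
          N₂ , h₂ = archimedean (half ε) (half-pos 0<ε)
          below : ∀ m n → N₁ ℕ.⊔ N₂ ℕ.≤ m → N₁ ℕ.⊔ N₂ ℕ.≤ n →
                  approxRoot m (s m) ℚ.< approxRoot n (s n) ℚ.+ ε
          below m n N≤m N≤n = root-close m n (0≤s m) (0≤s n) 0<ε
            (dist<⇒<+ (s m) (s n) (h₁ m n (ℕ.m⊔n≤o⇒m≤o N₁ N₂ N≤m) (ℕ.m⊔n≤o⇒m≤o N₁ N₂ N≤n)))
            (h₂ n (ℕ.m⊔n≤o⇒n≤o N₁ N₂ N≤n))
      in N₁ ℕ.⊔ N₂ , λ m n N≤m N≤n →
           <+⇒dist< (approxRoot m (s m)) (approxRoot n (s n)) (below m n N≤m N≤n) (below n m N≤n N≤m)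

open RootCauchy

-- The square root of max(0, x).
√_ : ℝ → ℝ
√ x = mkℝ (λ n → approxRoot n (seq (0ᴿ ⊔ᴿ x) n))
  (root-cauchy {seq (0ᴿ ⊔ᴿ x)} nonNeg (cauchy (0ᴿ ⊔ᴿ x)))
  where
  nonNeg : ∀ n → 0ℚ ℚ.≤ seq (0ᴿ ⊔ᴿ x) n
  nonNeg n = ℚ.p≤p⊔q 0ℚ (seq x n)

infix 8 √_

------------------------------------------------------------------------
-- Complex numbers

record ℂ : Set where
  constructor _+i_
  field
    re im : ℝ

open ℂ public

infix  4 _≈ᶜ_
infix  5 _+i_
infixl 6 _+ᶜ_
infixl 7 _*ᶜ_

record _≈ᶜ_ (z w : ℂ) : Set where
  constructor _,_
  field
    re-≈ : re z ≈ᴿ re w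
    im-≈ : im z ≈ᴿ im w

fromℝ : ℝ → ℂ
fromℝ x = x +i 0ᴿ

0ᶜ 1ᶜ : ℂ
0ᶜ = fromℝ 0ᴿ
1ᶜ = fromℝ 1ᴿ

_+ᶜ_ _*ᶜ_ : ℂ → ℂ → ℂ
z +ᶜ w = (re z +ᴿ re w) +i (im z +ᴿ im w)
z *ᶜ w = (re z *ᴿ re w -ᴿ im z *ᴿ im w) +i (re z *ᴿ im w +ᴿ im z *ᴿ re w)

∣_∣ᶜ : ℂ → ℝ
∣ z ∣ᶜ = √ (re z *ᴿ re z +ᴿ im z *ᴿ im z)

sumᶜ : List ℂ → ℂ
sumᶜ = List.foldr _+ᶜ_ 0ᶜ

------------------------------------------------------------------------
-- Finite rings

record FiniteRing (c ℓ : Level) : Set (lsuc (c ⊔ ℓ)) where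
  field
    ring        : Ring c ℓ
  open Ring ring public renaming (setoid to ≈-setoid)
  field
    1≉0         : ¬ (1# ≈ 0#)
    order       : ℕ
    enumeration : Inverse (setoid (Fin order)) ≈-setoid

  private module E = Inverse enumeration

  _≈?_ : Decidable _≈_
  x ≈? y = map′
    (λ eq → trans′ (sym′ (E.strictlyInverseˡ x)) (trans′ (E.to-cong eq) (E.strictlyInverseˡ y)))
    E.from-cong
    (E.from x Fin.≟ E.from y)
    where open Ring ring using () renaming (trans to trans′; sym to sym′)

  instance
    order-nonZero : ℕ.NonZero order
    order-nonZero = Fin.nonZeroIndex (E.from 0#)

  elements : List Carrier
  elements = List.map E.to (List.allFin order)

  vectors : (d : ℕ) → List (Vec Carrier d)
  vectors zero    = [] ∷ []
  vectors (suc d) = List.cartesianProductWith _∷_ elements (vectors d)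

  open VecEquality ≈-setoid public using (_≋_)

  infixl 6 _⊕_

  _⊕_ : ∀ {d} → Vec Carrier d → Vec Carrier d → Vec Carrier d
  _⊕_ = Vec.zipWith _+_

  infixr 7 _·_

  _·_ : ℤ → Carrier → Carrier
  (+ n)    · x = n ×# x where open RawMonoidDefs +-rawMonoid renaming (_×_ to _×#_)
  -[1+ n ] · x = - (suc n ×# x) where open RawMonoidDefs +-rawMonoid renaming (_×_ to _×#_)

-- A ring isomorphism R ≅ R₁ × R₂.
record ProductDecomposition {c ℓ c₁ ℓ₁ c₂ ℓ₂}
  (R : FiniteRing c ℓ) (R₁ : FiniteRing c₁ ℓ₁) (R₂ : FiniteRing c₂ ℓ₂) :
  Set (c ⊔ ℓ ⊔ c₁ ⊔ ℓ₁ ⊔ c₂ ⊔ ℓ₂) where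
  private
    module R  = FiniteRing R
    module R₁ = FiniteRing R₁
    module R₂ = FiniteRing R₂
  open RingMorphisms R.rawRing (DirectProduct.rawRing R₁.rawRing R₂.rawRing)
  field
    split             : R.Carrier → R₁.Carrier × R₂.Carrier
    isRingIsomorphism : IsRingIsomorphism split

------------------------------------------------------------------------
-- Polynomials in n noncommuting variables: ℤ-linear combinations of words

Word : ℕ → Set
Word n = List (Fin n)

Polynomial : ℕ → Set
Polynomial n = List (ℤ × Word n)

-- A word may be listed several times; its coefficient is then the sum.
constantTerm : ∀ {n} → Polynomial n → ℤ
constantTerm []                = 0ℤ
constantTerm ((a , [])    ∷ f) = a ℤ.+ constantTerm f
constantTerm ((_ , _ ∷ _) ∷ f) = constantTerm f

------------------------------------------------------------------------
-- Salem sets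

module _ {c ℓ : Level} (R : FiniteRing c ℓ) where

  open FiniteRing R

  evalWord : ∀ {n} → Word n → Vec Carrier n → Carrier
  evalWord w x = List.foldr (λ i p → Vec.lookup x i * p) 1# w

  eval : ∀ {n} → Polynomial n → Vec Carrier n → Carrier
  eval f x = List.foldr (λ (a , w) s → a · evalWord w x + s) 0# f

  record Subset (d : ℕ) : Set (lsuc (c ⊔ ℓ)) where
    field
      member : Pred (Vec Carrier d) ℓ
      resp   : ∀ {x y} → x ≋ y → member x → member y
      dec    : ∀ x → Dec (member x)

  open Subset

  members : ∀ {d} → Subset d → List (Vec Carrier d)
  members {d} S = List.filter (dec S) (vectors d)

  card : ∀ {d} → Subset d → ℕ
  card S = List.length (members S)

  -- A character of the additive group of R^d: a homomorphism to the unit circle.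
  record Character (d : ℕ) : Set (c ⊔ ℓ) where
    field
      χ         : Vec Carrier d → ℂ
      χ-cong    : ∀ {x y} → x ≋ y → χ x ≈ᶜ χ y
      χ-homo    : ∀ x y → χ (x ⊕ y) ≈ᶜ χ x *ᶜ χ y
      χ-modulus : ∀ x → ∣ χ x ∣ᶜ ≈ᴿ 1ᴿ

  open Character

  Nontrivial : ∀ {d} → Character d → Set c
  Nontrivial ψ = ¬ (∀ x → χ ψ x ≈ᶜ 1ᶜ)

  -- |R|^(-d)
  order⁻ : ℕ → ℝ
  order⁻ d = fromℚ (ℚ._/_ (+ 1) (order ℕ.^ d) {{ℕ.m^n≢0 order d}})

  fourier : ∀ {d} → Subset d → Character d → ℂ
  fourier {d} S ψ = fromℝ (order⁻ d) *ᶜ sumᶜ (List.map (χ ψ) (members S))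

  IsSalem : ∀ {d} → ℝ → Subset d → Set (c ⊔ ℓ)
  IsSalem {d} C S = (ψ : Character d) → Nontrivial ψ →
    ∣ fourier S ψ ∣ᶜ ≤ᴿ C *ᴿ order⁻ d *ᴿ √ (fromℕ (card S))

  module Congruence where
    module ≈ = Ring ring using (refl; sym; trans)

    last-cong : ∀ {n} {x y : Vec Carrier (suc n)} → x ≋ y → Vec.last x ≈ Vec.last y
    last-cong {zero}  {_ ∷ []} {_ ∷ []} (p ∷ []) = p
    last-cong {suc n} {_ ∷ _}  {_ ∷ _}  (p ∷ ps) = last-cong ps

    init-cong : ∀ {n} {x y : Vec Carrier (suc n)} → x ≋ y → Vec.init x ≋ Vec.init y
    init-cong {zero}  {_ ∷ []} {_ ∷ []} (p ∷ []) = []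
    init-cong {suc n} {_ ∷ _}  {_ ∷ _}  (p ∷ ps) = p ∷ init-cong ps

    lookup-cong : ∀ {n} {x y : Vec Carrier n} → x ≋ y → ∀ i → Vec.lookup x i ≈ Vec.lookup y i
    lookup-cong (p ∷ ps) Fin.zero    = p
    lookup-cong (p ∷ ps) (Fin.suc i) = lookup-cong ps i

    ×-cong : ∀ n {x y} → x ≈ y → RawMonoidDefs._×_ +-rawMonoid n x ≈ RawMonoidDefs._×_ +-rawMonoid n y
    ×-cong zero    p = ≈.refl
    ×-cong (suc n) p = +-cong p (×-cong n p)

    ·-cong : ∀ a {x y} → x ≈ y → a · x ≈ a · y
    ·-cong (+ n)    p = ×-cong n p
    ·-cong -[1+ n ] p = -‿cong (×-cong (suc n) p)

    evalWord-cong : ∀ {n} (w : Word n) {x y} → x ≋ y → evalWord w x ≈ evalWord w y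
    evalWord-cong []      p = ≈.refl
    evalWord-cong (i ∷ w) p = *-cong (lookup-cong p i) (evalWord-cong w p)

    eval-cong : ∀ {n} (f : Polynomial n) {x y} → x ≋ y → eval f x ≈ eval f y
    eval-cong []            p = ≈.refl
    eval-cong ((a , w) ∷ f) p = +-cong (·-cong a (evalWord-cong w p)) (eval-cong f p)

  open Congruence

  -- Lives in R^d for d = n + 1.
  V : ∀ {n} → Polynomial n → ℤ → Subset (suc n)
  V f k .member x = Vec.last x ≈ eval f (Vec.init x) + k · 1#
  V f k .resp p h = ≈.trans (≈.sym (last-cong p))
    (≈.trans h (+-cong (eval-cong f (init-cong p)) ≈.refl))
  V f k .dec x = Vec.last x ≈? (eval f (Vec.init x) + k · 1#)

  IsSalemNumber : ∀ {n} → Polynomial n → ℤ → ℝ → Set (c ⊔ ℓ)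
  IsSalemNumber f k C =
    IsSalem C (V f k) × (∀ C′ → IsSalem C′ (V f k) → C ≤ᴿ C′)

{-# OPTIONS --safe #-}

-- Under R ≅ R₁ × R₂ the set V(R) is V(R₁) × V(R₂), and a character ψ of R^d is a
-- product of its restrictions ψ₁ and ψ₂, so the sum of ψ over V(R) is the product
-- of the sums of ψ₁ and ψ₂.  If ψ is nontrivial, one restriction is nontrivial,
-- say ψ₁; bounding the sum of ψ₁ by C₁ |V(R₁)|^½ and that of ψ₂ by |V(R₂)| gives
-- the upper bound.  Conversely, for ψ₂ = 1 the sum is |V(R₂)| times the sum of ψ₁,
-- so C / |V(R₂)|^½ is a Salem constant for R₁ whenever C is one for R.
-- The power |R|^(-d) cancels throughout.
module Submission where

open import Defs
open CauchyLemmas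
open RootLemmas
open import Algebra.Bundles using (Ring)
import Algebra.Definitions.RawMonoid as RawMonoidDefs
open import Algebra.Morphism.Structures using (module RingMorphisms)
open import Algebra.Structures using (IsCommutativeMonoid)
open import Data.Fin.Base as Fin using (Fin)
open import Data.Integer.Base using (ℤ; 0ℤ; +_; -[1+_])
open import Data.List.Base as List using (List; []; _∷_; _++_)
import Data.List.Membership.Propositional.Properties as Propositional
import Data.List.Membership.Setoid as Membership
import Data.List.Membership.Setoid.Properties as Membershipₚ
open import Data.List.Properties using (length-map; length-++)
import Data.List.Relation.Binary.Permutation.Setoid as Permutation
import Data.List.Relation.Binary.Permutation.Setoid.Properties as Permutationₚ
open import Data.List.Relation.Unary.All using ([]; _∷_)
open import Data.List.Relation.Unary.All.Properties using (All¬⇒¬Any)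
open import Data.List.Relation.Unary.AllPairs using ([]; _∷_)
open import Data.List.Relation.Unary.Any using (here; there)
import Data.List.Relation.Unary.Unique.Propositional.Properties as UniqueP
import Data.List.Relation.Unary.Unique.Setoid as Unique
import Data.List.Relation.Unary.Unique.Setoid.Properties as Uniqueₚ
open import Data.Nat.Base as ℕ using (ℕ; zero; suc; _≤_)
import Data.Nat.Properties as ℕ
open import Data.Product.Base using (∃; _×_; _,_; proj₁; proj₂)
open import Data.Rational as ℚ using (ℚ; 0ℚ; 1ℚ)
import Data.Rational.Properties as ℚ
open import Data.Rational.Solver using (module +-*-Solver)
open +-*-Solver using (solve; _:=_; _:+_; _:*_; _:-_; :-_; con)
open import Data.Sum.Base using (inj₁; inj₂)
open import Data.Vec.Base as Vec using (Vec; []; _∷_)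
open import Data.Vec.Properties using (zipWith-comm)
import Data.Vec.Relation.Binary.Equality.Setoid as VecEquality
open import Data.Vec.Relation.Binary.Pointwise.Inductive using ([]; _∷_)
open import Function.Base using (_∘_)
open import Function.Bundles using (_⇔_; Inverse; mk⇔)
open import Level using (_⊔_; 0ℓ)
open import Relation.Binary.Bundles using (Poset; Setoid)
open import Relation.Binary.PropositionalEquality using (_≡_; refl; sym; trans; cong; cong₂; subst; subst₂; setoid)
open import Relation.Nullary using (¬_; yes; no)
open import Relation.Nullary.Negation using (contradiction)

-- Order and arithmetic on ℝ

-- The obstacle is constructive. `Nontrivial` negates a universal statement about equality of reals,
-- so a nontrivial character does not reveal which of its restrictions is nontrivial; one only knows
-- that they cannot both be trivial. The case distinction is therefore made under a double negation,
-- which can be removed because the bound to be proved is an inequality `_≤ᴿ_`, and such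
-- inequalities are stable. The other delicate point is division: the only quantities ever inverted
-- are positive rationals, namely a power of the order of the ring and the cardinality of V, which
-- is positive because V is a graph. The two factors play symmetric roles, so each argument is made
-- for the first one and transferred by `swap`.

private variable
  x y z u v : ℝ

Eventually : (ℕ → Set) → Set
Eventually P = ∃ λ N → ∀ n → N ℕ.≤ n → P n

always : ∀ {P} → (∀ n → P n) → Eventually P
always h = 0 , λ n _ → h n

_⟪_⟫_ : ∀ {P Q S : ℕ → Set} → Eventually P → (∀ n → P n → Q n → S n) → Eventually Q → Eventually S
(M , p) ⟪ f ⟫ (N , q) = M ℕ.⊔ N , λ n h →
  f n (p n (ℕ.m⊔n≤o⇒m≤o M N h)) (q n (ℕ.m⊔n≤o⇒n≤o M N h))

eventually-map : ∀ {P Q : ℕ → Set} → (∀ n → P n → Q n) → Eventually P → Eventually Q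
eventually-map f (N , p) = N , λ n h → f n (p n h)

p<p+ε : ∀ p {ε} → 0ℚ ℚ.< ε → p ℚ.< p ℚ.+ ε
p<p+ε p {ε} 0<ε = subst (ℚ._< p ℚ.+ ε) (ℚ.+-identityʳ p) (ℚ.+-monoʳ-< p 0<ε)

pointwise-≤ : (∀ n → seq x n ℚ.≤ seq y n) → x ≤ᴿ y
pointwise-≤ h = mk≤ λ ε 0<ε → always λ n → ℚ.≤-<-trans (h n) (p<p+ε _ 0<ε)

≈⇒≤ : x ≈ᴿ y → x ≤ᴿ y
≈⇒≤ h = mk≤ λ ε 0<ε → eventually-map (λ n → dist<⇒<+ _ _) (close h ε 0<ε)

≤-antisym : x ≤ᴿ y → y ≤ᴿ x → x ≈ᴿ y
≤-antisym h k = mk≈ λ ε 0<ε → below h ε 0<ε ⟪ (λ n → <+⇒dist< _ _) ⟫ below k ε 0<ε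

≈-sym : x ≈ᴿ y → y ≈ᴿ x
≈-sym {x} {y} h = mk≈ λ ε 0<ε →
  eventually-map (λ n → subst (ℚ._< ε) (dist-sym (seq x n) (seq y n))) (close h ε 0<ε)

pointwise-≈ : (∀ n → seq x n ≡ seq y n) → x ≈ᴿ y
pointwise-≈ h = ≤-antisym (pointwise-≤ λ n → ℚ.≤-reflexive (h n))
                          (pointwise-≤ λ n → ℚ.≤-reflexive (sym (h n)))

≤-trans : x ≤ᴿ y → y ≤ᴿ z → x ≤ᴿ z
≤-trans {x} {y} {z} h k = mk≤ λ ε 0<ε →
  below h (half ε) (half-pos 0<ε)
    ⟪ (λ n p q → ℚ.<-trans p (ℚ.<-≤-trans (ℚ.+-monoˡ-< (half ε) q)
        (ℚ.≤-reflexive (trans (ℚ.+-assoc (seq z n) (half ε) (half ε)) (cong (seq z n ℚ.+_) (half+half ε))))))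
    ⟫ below k (half ε) (half-pos 0<ε)

≈-refl : x ≈ᴿ x
≈-refl = pointwise-≈ λ _ → refl

≈-trans : x ≈ᴿ y → y ≈ᴿ z → x ≈ᴿ z
≈-trans h k = ≤-antisym (≤-trans (≈⇒≤ h) (≈⇒≤ k)) (≤-trans (≈⇒≤ (≈-sym k)) (≈⇒≤ (≈-sym h)))

≤-poset : Poset 0ℓ 0ℓ 0ℓ
≤-poset = record
  { _≈_ = _≈ᴿ_ ; _≤_ = _≤ᴿ_
  ; isPartialOrder = record
    { isPreorder = record
      { isEquivalence = record { refl = ≈-refl ; sym = ≈-sym ; trans = ≈-trans }
      ; reflexive = ≈⇒≤ ; trans = ≤-trans }
    ; antisym = ≤-antisym } }

module ≤ᴿ-Reasoning where
  open import Relation.Binary.Reasoning.PartialOrder ≤-poset public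

-- For late n the rational inequality seq x n < seq y n + ε is decidable, so it
-- may be proved by contradiction.
≤-stable : ¬ ¬ (x ≤ᴿ y) → x ≤ᴿ y
≤-stable {x} {y} ¬¬h = mk≤ λ ε 0<ε →
  let δ = half (half ε)
      0<δ = half-pos (half-pos 0<ε)
      M , cx = cauchy x δ 0<δ
      N , cy = cauchy y δ 0<δ
      K = M ℕ.⊔ N
      M≤ : ∀ {n} → K ℕ.≤ n → M ℕ.≤ n
      M≤ = ℕ.m⊔n≤o⇒m≤o M N
      N≤ : ∀ {n} → K ℕ.≤ n → N ℕ.≤ n
      N≤ = ℕ.m⊔n≤o⇒n≤o M N
  -- The threshold K comes from the Cauchy moduli alone: the witness P inside `h` is available only
  -- while a contradiction is being derived. The comparison of x and y is made at a later index m
  -- beyond P and carried back to n; this costs δ three times, and the fourth quarter of ε is slack.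
  in K , λ n K≤n → ℚ.≰⇒> λ y+ε≤x → ¬¬h λ h →
       let P , x<y = below h δ 0<δ
           m = K ℕ.⊔ P
           K≤m = ℕ.m≤m⊔n K P
       in ℚ.<-irrefl refl (begin-strict
            seq x n                                       <⟨ dist<⇒<+ _ _ (cx n m (M≤ K≤n) (M≤ K≤m)) ⟩
            seq x m ℚ.+ δ                                 <⟨ ℚ.+-monoˡ-< δ (x<y m (ℕ.m≤n⊔m K P)) ⟩
            seq y m ℚ.+ δ ℚ.+ δ                           <⟨ ℚ.+-monoˡ-< δ (ℚ.+-monoˡ-< δ (dist<⇒<+ (seq y m) (seq y n) (cy m n (N≤ K≤m) (N≤ K≤n)))) ⟩
            seq y n ℚ.+ δ ℚ.+ δ ℚ.+ δ                     <⟨ p<p+ε _ 0<δ ⟩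
            seq y n ℚ.+ δ ℚ.+ δ ℚ.+ δ ℚ.+ δ               ≡⟨ solve 2 (λ y e → y :+ con ℚ.½ :* (con ℚ.½ :* e) :+ con ℚ.½ :* (con ℚ.½ :* e)
                                                               :+ con ℚ.½ :* (con ℚ.½ :* e) :+ con ℚ.½ :* (con ℚ.½ :* e) := y :+ e) refl (seq y n) ε ⟩
            seq y n ℚ.+ ε                                 ≤⟨ y+ε≤x ⟩
            seq x n                                       ∎)
  where open ℚ.≤-Reasoning

+-mono-≤ : x ≤ᴿ y → u ≤ᴿ v → x +ᴿ u ≤ᴿ y +ᴿ v
+-mono-≤ {x} {y} {u} {v} h k = mk≤ λ ε 0<ε →
  below h (half ε) (half-pos 0<ε)
    ⟪ (λ n p q → ℚ.<-≤-trans (ℚ.+-mono-< p q) (ℚ.≤-reflexive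
        (solve 3 (λ y v e → (y :+ con ℚ.½ :* e) :+ (v :+ con ℚ.½ :* e) := (y :+ v) :+ e) refl (seq y n) (seq v n) ε)))
    ⟫ below k (half ε) (half-pos 0<ε)

+-cong : x ≈ᴿ y → u ≈ᴿ v → x +ᴿ u ≈ᴿ y +ᴿ v
+-cong h k = ≤-antisym (+-mono-≤ (≈⇒≤ h) (≈⇒≤ k)) (+-mono-≤ (≈⇒≤ (≈-sym h)) (≈⇒≤ (≈-sym k)))

-‿cong : x ≈ᴿ y → -ᴿ x ≈ᴿ -ᴿ y
-‿cong {x} {y} h = mk≈ λ ε 0<ε → eventually-map
  (λ n → subst (ℚ._< ε) (trans (sym (ℚ.∣-p∣≡∣p∣ (seq x n ℚ.- seq y n)))
    (cong ℚ.∣_∣ (solve 2 (λ p q → :- (p :- q) := (:- p) :- (:- q)) refl (seq x n) (seq y n)))))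
  (close h ε 0<ε)

*-congˡ : x ≈ᴿ y → z *ᴿ x ≈ᴿ z *ᴿ y
*-congˡ {x} {y} {z} h = mk≈ λ ε 0<ε →
  let B , 0<B , bound = bounded (cauchy z)
      δ , 0<δ , Bδ≡ε = divide 0<B 0<ε
  in bound ⟪ (λ n b d → subst₂ ℚ._<_
       (cong ℚ.∣_∣ (solve 3 (λ z x y → z :* (x :- y) := z :* x :- z :* y) refl (seq z n) (seq x n) (seq y n)))
       Bδ≡ε (*-bound-< (seq z n) (seq x n ℚ.- seq y n) 0<B b d)) ⟫ close h δ 0<δ

*-comm : ∀ x y → x *ᴿ y ≈ᴿ y *ᴿ x
*-comm x y = pointwise-≈ λ n → ℚ.*-comm (seq x n) (seq y n)

*-cong : x ≈ᴿ y → u ≈ᴿ v → x *ᴿ u ≈ᴿ y *ᴿ v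
*-cong {x} {y} {u} {v} h k = ≈-trans (*-congˡ k)
  (≈-trans (*-comm x v) (≈-trans (*-congˡ h) (*-comm v y)))

-- Pointwise, hence stronger than 0ᴿ ≤ᴿ x.
NonNeg : ℝ → Set
NonNeg x = ∀ n → 0ℚ ℚ.≤ seq x n

0≤*-ℚ : ∀ {p q} → 0ℚ ℚ.≤ p → 0ℚ ℚ.≤ q → 0ℚ ℚ.≤ p ℚ.* q
0≤*-ℚ {p} {q} 0≤p 0≤q = ℚ.nonNegative⁻¹ (p ℚ.* q)
  {{ℚ.nonNeg*nonNeg⇒nonNeg p {{ℚ.nonNegative 0≤p}} q {{ℚ.nonNegative 0≤q}}}}

*-nonNeg : NonNeg x → NonNeg y → NonNeg (x *ᴿ y)
*-nonNeg h k n = 0≤*-ℚ (h n) (k n)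

*-monoˡ-≤ : NonNeg z → x ≤ᴿ y → z *ᴿ x ≤ᴿ z *ᴿ y
*-monoˡ-≤ {z} {x} {y} 0≤z h = mk≤ λ ε 0<ε →
  let B , 0<B , bound = bounded (cauchy z)
      -- Multiplying by `z`, which may vanish, makes the strict inequality weak; half of ε is kept
      -- back to restore strictness at the end.
      δ , 0<δ , Bδ≡ε = divide 0<B (half-pos 0<ε)
  in bound ⟪ (λ n b d → let open ℚ.≤-Reasoning in begin-strict
       seq z n ℚ.* seq x n                          ≤⟨ ℚ.*-monoˡ-≤-nonNeg (seq z n) {{ℚ.nonNegative (0≤z n)}} (ℚ.<⇒≤ d) ⟩
       seq z n ℚ.* (seq y n ℚ.+ δ)                  ≡⟨ ℚ.*-distribˡ-+ (seq z n) (seq y n) δ ⟩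
       seq z n ℚ.* seq y n ℚ.+ seq z n ℚ.* δ        ≤⟨ ℚ.+-monoʳ-≤ (seq z n ℚ.* seq y n)
                                                         (ℚ.*-monoʳ-≤-nonNeg δ {{ℚ.nonNegative (ℚ.<⇒≤ 0<δ)}}
                                                           (subst (ℚ._≤ B) (ℚ.0≤p⇒∣p∣≡p (0≤z n)) b)) ⟩
       seq z n ℚ.* seq y n ℚ.+ B ℚ.* δ              ≡⟨ cong (seq z n ℚ.* seq y n ℚ.+_) Bδ≡ε ⟩
       seq z n ℚ.* seq y n ℚ.+ half ε               <⟨ p<p+ε _ (half-pos 0<ε) ⟩
       seq z n ℚ.* seq y n ℚ.+ half ε ℚ.+ half ε    ≡⟨ ℚ.+-assoc (seq z n ℚ.* seq y n) (half ε) (half ε) ⟩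
       seq z n ℚ.* seq y n ℚ.+ (half ε ℚ.+ half ε)  ≡⟨ cong (seq z n ℚ.* seq y n ℚ.+_) (half+half ε) ⟩
       seq z n ℚ.* seq y n ℚ.+ ε                    ∎) ⟫ below h δ 0<δ

*-monoʳ-≤ : NonNeg z → x ≤ᴿ y → x *ᴿ z ≤ᴿ y *ᴿ z
*-monoʳ-≤ {z} {x} {y} 0≤z h = ≤-trans (≈⇒≤ (*-comm x z)) (≤-trans (*-monoˡ-≤ 0≤z h) (≈⇒≤ (*-comm z y)))

module _ (q : ℚ) .{{_ : ℚ.Positive q}} where

  private instance
    q≢0 : ℚ.NonZero q
    q≢0 = ℚ.pos⇒nonZero q

  1/-cancelˡ : ∀ p → ℚ.1/ q ℚ.* (q ℚ.* p) ≡ p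
  1/-cancelˡ p = trans (sym (ℚ.*-assoc (ℚ.1/ q) q p))
    (trans (cong (ℚ._* p) (ℚ.*-inverseˡ q)) (ℚ.*-identityˡ p))

  -- Multiplication by the constant sequence of the inverse of `q` is monotone and undoes
  -- multiplication by `q` term by term, so no inverse of a real number is formed.
  *-cancelˡ-≤ : fromℚ q *ᴿ x ≤ᴿ fromℚ q *ᴿ y → x ≤ᴿ y
  *-cancelˡ-≤ {x} {y} h = begin
    x                                  ≈⟨ pointwise-≈ (λ n → 1/-cancelˡ (seq x n)) ⟨
    fromℚ (ℚ.1/ q) *ᴿ (fromℚ q *ᴿ x)   ≤⟨ *-monoˡ-≤ (λ _ → ℚ.<⇒≤ (ℚ.positive⁻¹ _ {{ℚ.1/pos⇒pos q}})) h ⟩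
    fromℚ (ℚ.1/ q) *ᴿ (fromℚ q *ᴿ y)   ≈⟨ pointwise-≈ (λ n → 1/-cancelˡ (seq y n)) ⟩
    y                                  ∎
    where open ≤ᴿ-Reasoning

x≤x⊔y : ∀ x y → x ≤ᴿ x ⊔ᴿ y
x≤x⊔y x y = pointwise-≤ λ n → ℚ.p≤p⊔q (seq x n) (seq y n)

y≤x⊔y : ∀ x y → y ≤ᴿ x ⊔ᴿ y
y≤x⊔y x y = pointwise-≤ λ n → ℚ.p≤q⊔p (seq x n) (seq y n)

⊔-lub : x ≤ᴿ z → y ≤ᴿ z → x ⊔ᴿ y ≤ᴿ z
⊔-lub {x} {z} {y} h k = mk≤ λ ε 0<ε →
  below h ε 0<ε ⟪ (λ n p q → lub p q) ⟫ below k ε 0<ε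
  where
  lub : ∀ {p q r} → p ℚ.< r → q ℚ.< r → p ℚ.⊔ q ℚ.< r
  lub {p} {q} {r} p<r q<r with p ℚ.≤? q
  ... | yes p≤q = subst (ℚ._< r) (sym (ℚ.p≤q⇒p⊔q≡q p≤q)) q<r
  ... | no  p≰q = subst (ℚ._< r) (sym (ℚ.p≥q⇒p⊔q≡p (ℚ.<⇒≤ (ℚ.≰⇒> p≰q)))) p<r

-- Squares and square roots of reals

square-cancel-≤ : NonNeg y → x *ᴿ x ≤ᴿ y *ᴿ y → x ≤ᴿ y
square-cancel-≤ {y} {x} 0≤y h = mk≤ λ ε 0<ε → eventually-map
  -- A tolerance of ε² on the squares suffices: if a term of x were at least y + ε, its square would
  -- be at least (y + ε)², hence at least y² + ε², since the cross term 2yε is nonnegative.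
  (λ n x²<y²+ε² → ℚ.≰⇒> λ y+ε≤x → ℚ.<-irrefl refl (begin-strict
    sq (seq x n)                          <⟨ x²<y²+ε² ⟩
    sq (seq y n) ℚ.+ sq ε                 ≡⟨ ℚ.+-identityʳ _ ⟨
    (sq (seq y n) ℚ.+ sq ε) ℚ.+ 0ℚ        ≤⟨ ℚ.+-monoʳ-≤ (sq (seq y n) ℚ.+ sq ε)
                                               (ℚ.+-mono-≤ (0≤*-ℚ (0≤y n) (ℚ.<⇒≤ 0<ε)) (0≤*-ℚ (0≤y n) (ℚ.<⇒≤ 0<ε))) ⟩
    (sq (seq y n) ℚ.+ sq ε) ℚ.+ (seq y n ℚ.* ε ℚ.+ seq y n ℚ.* ε)
      ≡⟨ solve 2 (λ y e → (y :* y :+ e :* e) :+ (y :* e :+ y :* e) := (y :+ e) :* (y :+ e)) refl (seq y n) ε ⟩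
    sq (seq y n ℚ.+ ε)                    ≤⟨ sq-mono-≤ (ℚ.+-mono-≤ (0≤y n) (ℚ.<⇒≤ 0<ε)) y+ε≤x ⟩
    sq (seq x n)                          ∎))
  (below h (sq ε) (*-pos 0<ε 0<ε))
  where open ℚ.≤-Reasoning

square-cancel-≈ : NonNeg x → NonNeg y → x *ᴿ x ≈ᴿ y *ᴿ y → x ≈ᴿ y
square-cancel-≈ 0≤x 0≤y h =
  ≤-antisym (square-cancel-≤ 0≤y (≈⇒≤ h)) (square-cancel-≤ 0≤x (≈⇒≤ (≈-sym h)))

√-nonNeg : ∀ x → NonNeg (√ x)
√-nonNeg x n = approxRoot-nonNeg n (0ℚ ℚ.⊔ seq x n)

√-square : NonNeg x → √ x *ᴿ √ x ≈ᴿ x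
√-square {x} 0≤x = mk≈ λ ε 0<ε →
  let B , 0<B , bound = bounded (cauchy (√ x))
      -- For the approximate root r and the mesh h, the square of r + h exceeds r² by (r + r + h) h.
      -- The first factor is eventually at most D, because r ≤ B and h ≤ 1, and h ≤ δ makes the
      -- product at most ε.
      D = B ℚ.+ B ℚ.+ 1ℚ
      0<D = ℚ.+-mono-< (ℚ.+-mono-< 0<B 0<B) (ℚ.positive⁻¹ 1ℚ)
      δ , 0<δ , Dδ≡ε = divide 0<D 0<ε
  in bound ⟪ (λ n b (h≤1 , h≤δ) →
       let r = seq (√ x) n
           h = grid 1 n
           r≤B = subst (ℚ._≤ B) (ℚ.0≤p⇒∣p∣≡p (√-nonNeg x n)) b
           s≡x = ℚ.p≤q⇒p⊔q≡q (0≤x n)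
           s<r²+ε = begin-strict
             0ℚ ℚ.⊔ seq x n                <⟨ approxRoot-upper n (0ℚ ℚ.⊔ seq x n) (ℚ.p≤p⊔q 0ℚ (seq x n)) ⟩
             sq (r ℚ.+ h)                  ≡⟨ solve 2 (λ r h → (r :+ h) :* (r :+ h) := r :* r :+ (r :+ r :+ h) :* h) refl r h ⟩
             sq r ℚ.+ (r ℚ.+ r ℚ.+ h) ℚ.* h  ≤⟨ ℚ.+-monoʳ-≤ (sq r) (ℚ.≤-trans
                  (ℚ.*-monoʳ-≤-nonNeg h {{ℚ.nonNegative (grid-nonNeg 1 n)}} (ℚ.+-mono-≤ (ℚ.+-mono-≤ r≤B r≤B) h≤1))
                  (ℚ.*-monoˡ-≤-nonNeg D {{ℚ.nonNegative (ℚ.<⇒≤ 0<D)}} h≤δ)) ⟩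
             sq r ℚ.+ D ℚ.* δ              ≡⟨ cong (sq r ℚ.+_) Dδ≡ε ⟩
             sq r ℚ.+ ε                    ∎
           r²<s+ε = ℚ.≤-<-trans (approxRoot-lower n (0ℚ ℚ.⊔ seq x n) (ℚ.p≤p⊔q 0ℚ (seq x n))) (p<p+ε _ 0<ε)
       in <+⇒dist< (sq r) (seq x n)
            (subst (λ s → sq r ℚ.< s ℚ.+ ε) s≡x r²<s+ε)
            (subst (ℚ._< sq r ℚ.+ ε) s≡x s<r²+ε))
     ⟫ (archimedean 1ℚ (ℚ.positive⁻¹ 1ℚ) ⟪ (λ _ p q → p , q) ⟫ archimedean δ 0<δ)
  where open ℚ.≤-Reasoning

-- Later identities for roots and moduli are obtained from this by squaring, without returning to
-- the rational approximations of the root.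
√-unique : NonNeg x → NonNeg y → y *ᴿ y ≈ᴿ x → √ x ≈ᴿ y
√-unique {x} 0≤x 0≤y h = square-cancel-≈ (√-nonNeg x) 0≤y (≈-trans (√-square 0≤x) (≈-sym h))

√-* : NonNeg x → NonNeg y → √ (x *ᴿ y) ≈ᴿ √ x *ᴿ √ y
√-* {x} {y} 0≤x 0≤y = √-unique {x *ᴿ y} {√ x *ᴿ √ y}
  (*-nonNeg {x} {y} 0≤x 0≤y) (*-nonNeg {√ x} {√ y} (√-nonNeg x) (√-nonNeg y))
  (≈-trans (pointwise-≈ λ n → solve 2 (λ a b → (a :* b) :* (a :* b) := (a :* a) :* (b :* b)) refl (seq (√ x) n) (seq (√ y) n))
    (*-cong (√-square {x} 0≤x) (√-square {y} 0≤y)))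

√-cong : NonNeg x → NonNeg y → x ≈ᴿ y → √ x ≈ᴿ √ y
√-cong {x} {y} 0≤x 0≤y h = √-unique {x} {√ y} 0≤x (√-nonNeg y) (≈-trans (√-square {y} 0≤y) (≈-sym h))

-- Natural numbers as reals

fromℕ-nonNeg : ∀ m → NonNeg (fromℕ m)
fromℕ-nonNeg m _ = grid-nonNeg m 0

-- The constant value of `fromℕ m` is `grid m 0` by definition, so the lemmas on the grid of mesh 1
-- apply.
fromℕ-suc : ∀ m → fromℕ (suc m) ≈ᴿ 1ᴿ +ᴿ fromℕ m
fromℕ-suc m = pointwise-≈ λ _ → trans (grid-suc m 0) (ℚ.+-comm (grid m 0) 1ℚ)

fromℕ-+ : ∀ a b → fromℕ (a ℕ.+ b) ≈ᴿ fromℕ a +ᴿ fromℕ b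
fromℕ-+ zero    b = pointwise-≈ λ _ → sym (ℚ.+-identityˡ (grid b 0))
fromℕ-+ (suc a) b = begin
  fromℕ (suc (a ℕ.+ b))          ≈⟨ fromℕ-suc (a ℕ.+ b) ⟩
  1ᴿ +ᴿ fromℕ (a ℕ.+ b)          ≈⟨ +-cong ≈-refl (fromℕ-+ a b) ⟩
  1ᴿ +ᴿ (fromℕ a +ᴿ fromℕ b)     ≈⟨ pointwise-≈ (λ _ → sym (ℚ.+-assoc 1ℚ (grid a 0) (grid b 0))) ⟩
  1ᴿ +ᴿ fromℕ a +ᴿ fromℕ b       ≈⟨ +-cong (fromℕ-suc a) ≈-refl ⟨
  fromℕ (suc a) +ᴿ fromℕ b       ∎
  where open import Relation.Binary.Reasoning.Setoid (Poset.Eq.setoid ≤-poset)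

fromℕ-* : ∀ a b → fromℕ (a ℕ.* b) ≈ᴿ fromℕ a *ᴿ fromℕ b
fromℕ-* zero    b = pointwise-≈ λ _ → sym (ℚ.*-zeroˡ (grid b 0))
fromℕ-* (suc a) b = begin
  fromℕ (b ℕ.+ a ℕ.* b)              ≈⟨ fromℕ-+ b (a ℕ.* b) ⟩
  fromℕ b +ᴿ fromℕ (a ℕ.* b)         ≈⟨ +-cong ≈-refl (fromℕ-* a b) ⟩
  fromℕ b +ᴿ fromℕ a *ᴿ fromℕ b      ≈⟨ pointwise-≈ (λ _ → solve 2 (λ a b → b :+ a :* b := (con 1ℚ :+ a) :* b) refl (grid a 0) (grid b 0)) ⟩
  (1ᴿ +ᴿ fromℕ a) *ᴿ fromℕ b         ≈⟨ *-cong (fromℕ-suc a) ≈-refl ⟨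
  fromℕ (suc a) *ᴿ fromℕ b           ∎
  where open import Relation.Binary.Reasoning.Setoid (Poset.Eq.setoid ≤-poset)

-- Complex numbers

ℂ-setoid : Setoid 0ℓ 0ℓ
ℂ-setoid = record
  { _≈_ = _≈ᶜ_
  ; isEquivalence = record
    { refl  = ≈-refl , ≈-refl
    ; sym   = λ (p , q) → ≈-sym p , ≈-sym q
    ; trans = λ (p , q) (p′ , q′) → ≈-trans p p′ , ≈-trans q q′ } }

module ≈ᶜ = Setoid ℂ-setoid

pointwise-≈ᶜ : ∀ {z w} → (∀ n → seq (re z) n ≡ seq (re w) n) → (∀ n → seq (im z) n ≡ seq (im w) n) → z ≈ᶜ w
pointwise-≈ᶜ p q = pointwise-≈ p , pointwise-≈ q

+ᶜ-cong : ∀ {a b z w} → a ≈ᶜ b → z ≈ᶜ w → a +ᶜ z ≈ᶜ b +ᶜ w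
+ᶜ-cong (p , q) (p′ , q′) = +-cong p p′ , +-cong q q′

*ᶜ-cong : ∀ {a b z w} → a ≈ᶜ b → z ≈ᶜ w → a *ᶜ z ≈ᶜ b *ᶜ w
*ᶜ-cong (p , q) (p′ , q′) =
  +-cong (*-cong p p′) (-‿cong (*-cong q q′)) , +-cong (*-cong p q′) (*-cong q p′)

+ᶜ-isCommutativeMonoid : IsCommutativeMonoid _≈ᶜ_ _+ᶜ_ 0ᶜ
+ᶜ-isCommutativeMonoid = record
  { isMonoid = record
    { isSemigroup = record
      { isMagma = record { isEquivalence = ≈ᶜ.isEquivalence ; ∙-cong = +ᶜ-cong }
      ; assoc = λ a b c → pointwise-≈ᶜ (λ n → ℚ.+-assoc (seq (re a) n) (seq (re b) n) (seq (re c) n))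
                                       (λ n → ℚ.+-assoc (seq (im a) n) (seq (im b) n) (seq (im c) n)) }
    ; identity = (λ a → pointwise-≈ᶜ (λ n → ℚ.+-identityˡ (seq (re a) n)) (λ n → ℚ.+-identityˡ (seq (im a) n)))
               , (λ a → pointwise-≈ᶜ (λ n → ℚ.+-identityʳ (seq (re a) n)) (λ n → ℚ.+-identityʳ (seq (im a) n))) }
  ; comm = λ a b → pointwise-≈ᶜ (λ n → ℚ.+-comm (seq (re a) n) (seq (re b) n))
                                (λ n → ℚ.+-comm (seq (im a) n) (seq (im b) n)) }

module +ᶜ = IsCommutativeMonoid +ᶜ-isCommutativeMonoid

*ᶜ-identityʳ : ∀ z → z *ᶜ 1ᶜ ≈ᶜ z
*ᶜ-identityʳ z = pointwise-≈ᶜ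
  (λ n → solve 2 (λ a b → a :* con 1ℚ :- b :* con 0ℚ := a) refl (seq (re z) n) (seq (im z) n))
  (λ n → solve 2 (λ a b → a :* con 0ℚ :+ b :* con 1ℚ := b) refl (seq (re z) n) (seq (im z) n))

*ᶜ-zeroˡ : ∀ z → 0ᶜ *ᶜ z ≈ᶜ 0ᶜ
*ᶜ-zeroˡ z = pointwise-≈ᶜ
  (λ n → solve 2 (λ a b → con 0ℚ :* a :- con 0ℚ :* b := con 0ℚ) refl (seq (re z) n) (seq (im z) n))
  (λ n → solve 2 (λ a b → con 0ℚ :* b :+ con 0ℚ :* a := con 0ℚ) refl (seq (re z) n) (seq (im z) n))

*ᶜ-zeroʳ : ∀ z → z *ᶜ 0ᶜ ≈ᶜ 0ᶜ
*ᶜ-zeroʳ z = pointwise-≈ᶜ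
  (λ n → solve 2 (λ a b → a :* con 0ℚ :- b :* con 0ℚ := con 0ℚ) refl (seq (re z) n) (seq (im z) n))
  (λ n → solve 2 (λ a b → a :* con 0ℚ :+ b :* con 0ℚ := con 0ℚ) refl (seq (re z) n) (seq (im z) n))

*ᶜ-distribˡ : ∀ a z w → a *ᶜ (z +ᶜ w) ≈ᶜ a *ᶜ z +ᶜ a *ᶜ w
*ᶜ-distribˡ (a +i b) (c +i d) (e +i f) = pointwise-≈ᶜ
  (λ n → solve 6 (λ a b c d e f → a :* (c :+ e) :- b :* (d :+ f) := (a :* c :- b :* d) :+ (a :* e :- b :* f)) refl
           (seq a n) (seq b n) (seq c n) (seq d n) (seq e n) (seq f n))
  (λ n → solve 6 (λ a b c d e f → a :* (d :+ f) :+ b :* (c :+ e) := (a :* d :+ b :* c) :+ (a :* f :+ b :* e)) refl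
           (seq a n) (seq b n) (seq c n) (seq d n) (seq e n) (seq f n))

*ᶜ-distribʳ : ∀ a z w → (z +ᶜ w) *ᶜ a ≈ᶜ z *ᶜ a +ᶜ w *ᶜ a
*ᶜ-distribʳ (a +i b) (c +i d) (e +i f) = pointwise-≈ᶜ
  (λ n → solve 6 (λ a b c d e f → (c :+ e) :* a :- (d :+ f) :* b := (c :* a :- d :* b) :+ (e :* a :- f :* b)) refl
           (seq a n) (seq b n) (seq c n) (seq d n) (seq e n) (seq f n))
  (λ n → solve 6 (λ a b c d e f → (c :+ e) :* b :+ (d :+ f) :* a := (c :* b :+ d :* a) :+ (e :* b :+ f :* a)) refl
           (seq a n) (seq b n) (seq c n) (seq d n) (seq e n) (seq f n))

-- The complex modulus

normSq : ℂ → ℝ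
normSq z = re z *ᴿ re z +ᴿ im z *ᴿ im z

0≤p² : ∀ p → 0ℚ ℚ.≤ p ℚ.* p
0≤p² p with ℚ.∣p∣≡p∨∣p∣≡-p p
... | inj₁ ∣p∣≡p  = sq-mono-≤ ℚ.≤-refl (subst (0ℚ ℚ.≤_) ∣p∣≡p (ℚ.0≤∣p∣ p))
... | inj₂ ∣p∣≡-p = subst (0ℚ ℚ.≤_) (solve 1 (λ p → (:- p) :* (:- p) := p :* p) refl p)
  (sq-mono-≤ ℚ.≤-refl (subst (0ℚ ℚ.≤_) ∣p∣≡-p (ℚ.0≤∣p∣ p)))

normSq-nonNeg : ∀ z → NonNeg (normSq z)
normSq-nonNeg z n = ℚ.+-mono-≤ (0≤p² (seq (re z) n)) (0≤p² (seq (im z) n))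

abs-nonNeg : ∀ z → NonNeg ∣ z ∣ᶜ
abs-nonNeg z = √-nonNeg (normSq z)

abs-square : ∀ z → ∣ z ∣ᶜ *ᴿ ∣ z ∣ᶜ ≈ᴿ normSq z
abs-square z = √-square (normSq-nonNeg z)

abs-cong : ∀ {z w} → z ≈ᶜ w → ∣ z ∣ᶜ ≈ᴿ ∣ w ∣ᶜ
abs-cong {z} {w} (p , q) =
  √-cong (normSq-nonNeg z) (normSq-nonNeg w) (+-cong (*-cong p p) (*-cong q q))

-- The two-square identity makes `normSq` multiplicative, and the root of a product of nonnegative
-- reals is the product of the roots.
abs-* : ∀ z w → ∣ z *ᶜ w ∣ᶜ ≈ᴿ ∣ z ∣ᶜ *ᴿ ∣ w ∣ᶜ
abs-* z@(a +i b) w@(c +i d) = ≈-trans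
  (√-cong (normSq-nonNeg (z *ᶜ w)) (*-nonNeg {normSq z} {normSq w} (normSq-nonNeg z) (normSq-nonNeg w))
    (pointwise-≈ λ n → solve 4 (λ a b c d →
         (a :* c :- b :* d) :* (a :* c :- b :* d) :+ (a :* d :+ b :* c) :* (a :* d :+ b :* c)
         := (a :* a :+ b :* b) :* (c :* c :+ d :* d)) refl (seq a n) (seq b n) (seq c n) (seq d n)))
  (√-* {normSq z} {normSq w} (normSq-nonNeg z) (normSq-nonNeg w))

abs-fromℝ : ∀ x → NonNeg x → ∣ fromℝ x ∣ᶜ ≈ᴿ x
abs-fromℝ x 0≤x = √-unique (normSq-nonNeg (fromℝ x)) 0≤x
  (pointwise-≈ λ n → solve 1 (λ a → a :* a := a :* a :+ con 0ℚ :* con 0ℚ) refl (seq x n))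

-- Cauchy–Schwarz: (ac + bd)² + (ad − bc)² = (a² + b²)(c² + d²).
re-inner-≤ : ∀ z w → re z *ᴿ re w +ᴿ im z *ᴿ im w ≤ᴿ ∣ z ∣ᶜ *ᴿ ∣ w ∣ᶜ
re-inner-≤ z@(a +i b) w@(c +i d) = square-cancel-≤
  (*-nonNeg {∣ z ∣ᶜ} {∣ w ∣ᶜ} (abs-nonNeg z) (abs-nonNeg w)) (begin
    (a *ᴿ c +ᴿ b *ᴿ d) *ᴿ (a *ᴿ c +ᴿ b *ᴿ d)
      ≤⟨ pointwise-≤ (λ n → lagrange (seq a n) (seq b n) (seq c n) (seq d n)) ⟩
    normSq z *ᴿ normSq w
      ≈⟨ *-cong (abs-square z) (abs-square w) ⟨
    (∣ z ∣ᶜ *ᴿ ∣ z ∣ᶜ) *ᴿ (∣ w ∣ᶜ *ᴿ ∣ w ∣ᶜ)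
      ≈⟨ pointwise-≈ (λ n → solve 2 (λ p q → (p :* p) :* (q :* q) := (p :* q) :* (p :* q)) refl (seq ∣ z ∣ᶜ n) (seq ∣ w ∣ᶜ n)) ⟩
    (∣ z ∣ᶜ *ᴿ ∣ w ∣ᶜ) *ᴿ (∣ z ∣ᶜ *ᴿ ∣ w ∣ᶜ) ∎)
  where
  open ≤ᴿ-Reasoning
  lagrange : ∀ a b c d → sq (a ℚ.* c ℚ.+ b ℚ.* d) ℚ.≤ (a ℚ.* a ℚ.+ b ℚ.* b) ℚ.* (c ℚ.* c ℚ.+ d ℚ.* d)
  lagrange a b c d = subst₂ ℚ._≤_ (ℚ.+-identityʳ _)
    (solve 4 (λ a b c d → (a :* c :+ b :* d) :* (a :* c :+ b :* d) :+ (a :* d :- b :* c) :* (a :* d :- b :* c)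
                         := (a :* a :+ b :* b) :* (c :* c :+ d :* d)) refl a b c d)
    (ℚ.+-monoʳ-≤ (sq (a ℚ.* c ℚ.+ b ℚ.* d)) (0≤p² (a ℚ.* d ℚ.- b ℚ.* c)))

-- After squaring, the two sides differ only in the cross term, which `re-inner-≤` bounds.
abs-triangle : ∀ z w → ∣ z +ᶜ w ∣ᶜ ≤ᴿ ∣ z ∣ᶜ +ᴿ ∣ w ∣ᶜ
abs-triangle z@(a +i b) w@(c +i d) = square-cancel-≤
  (λ n → ℚ.+-mono-≤ (abs-nonNeg z n) (abs-nonNeg w n)) (begin
    ∣ z +ᶜ w ∣ᶜ *ᴿ ∣ z +ᶜ w ∣ᶜ
      ≈⟨ abs-square (z +ᶜ w) ⟩
    normSq (z +ᶜ w)
      ≈⟨ pointwise-≈ (λ n → solve 4 (λ a b c d → (a :+ c) :* (a :+ c) :+ (b :+ d) :* (b :+ d)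
           := ((a :* a :+ b :* b) :+ (c :* c :+ d :* d)) :+ ((a :* c :+ b :* d) :+ (a :* c :+ b :* d))) refl
           (seq a n) (seq b n) (seq c n) (seq d n)) ⟩
    (normSq z +ᴿ normSq w) +ᴿ ((a *ᴿ c +ᴿ b *ᴿ d) +ᴿ (a *ᴿ c +ᴿ b *ᴿ d))
      ≤⟨ +-mono-≤ (≈⇒≤ (+-cong (≈-sym (abs-square z)) (≈-sym (abs-square w)))) (+-mono-≤ (re-inner-≤ z w) (re-inner-≤ z w)) ⟩
    (∣ z ∣ᶜ *ᴿ ∣ z ∣ᶜ +ᴿ ∣ w ∣ᶜ *ᴿ ∣ w ∣ᶜ) +ᴿ (∣ z ∣ᶜ *ᴿ ∣ w ∣ᶜ +ᴿ ∣ z ∣ᶜ *ᴿ ∣ w ∣ᶜ)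
      ≈⟨ pointwise-≈ (λ n → solve 2 (λ p q → (p :* p :+ q :* q) :+ (p :* q :+ p :* q) := (p :+ q) :* (p :+ q)) refl
           (seq ∣ z ∣ᶜ n) (seq ∣ w ∣ᶜ n)) ⟩
    (∣ z ∣ᶜ +ᴿ ∣ w ∣ᶜ) *ᴿ (∣ z ∣ᶜ +ᴿ ∣ w ∣ᶜ) ∎)
  where open ≤ᴿ-Reasoning

-- Finite sums of complex numbers

module _ {a} {A : Set a} where

  ∑ : (A → ℂ) → List A → ℂ
  ∑ g xs = sumᶜ (List.map g xs)

  ∑-++ : ∀ g xs ys → ∑ g (xs ++ ys) ≈ᶜ ∑ g xs +ᶜ ∑ g ys
  ∑-++ g []       ys = ≈ᶜ.sym (+ᶜ.identityˡ _)
  ∑-++ g (x ∷ xs) ys = ≈ᶜ.trans (+ᶜ-cong ≈ᶜ.refl (∑-++ g xs ys)) (≈ᶜ.sym (+ᶜ.assoc (g x) (∑ g xs) (∑ g ys)))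

  ∑-1 : ∀ xs → ∑ (λ _ → 1ᶜ) xs ≈ᶜ fromℝ (fromℕ (List.length xs))
  ∑-1 []       = ≈ᶜ.refl
  ∑-1 (x ∷ xs) = ≈ᶜ.trans (+ᶜ-cong ≈ᶜ.refl (∑-1 xs))
    (≈-sym (fromℕ-suc (List.length xs)) , pointwise-≈ λ _ → refl)

  -- The trivial bound, for the factor on which the character may be trivial and no Salem estimate
  -- is available.
  abs-∑-≤ : ∀ g → (∀ x → ∣ g x ∣ᶜ ≈ᴿ 1ᴿ) → ∀ xs → ∣ ∑ g xs ∣ᶜ ≤ᴿ fromℕ (List.length xs)
  abs-∑-≤ g ∣g∣≈1 []       = ≈⇒≤ (abs-fromℝ 0ᴿ λ _ → ℚ.≤-refl)
  abs-∑-≤ g ∣g∣≈1 (x ∷ xs) = begin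
    ∣ g x +ᶜ ∑ g xs ∣ᶜ             ≤⟨ abs-triangle (g x) (∑ g xs) ⟩
    ∣ g x ∣ᶜ +ᴿ ∣ ∑ g xs ∣ᶜ        ≤⟨ +-mono-≤ (≈⇒≤ (∣g∣≈1 x)) (abs-∑-≤ g ∣g∣≈1 xs) ⟩
    1ᴿ +ᴿ fromℕ (List.length xs)   ≈⟨ fromℕ-suc (List.length xs) ⟨
    fromℕ (suc (List.length xs))   ∎
    where open ≤ᴿ-Reasoning

module _ {a b c} {A : Set a} {B : Set b} {D : Set c} (j : A → B → D)
         (g : D → ℂ) (α : A → ℂ) (β : B → ℂ) (g≈αβ : ∀ x y → g (j x y) ≈ᶜ α x *ᶜ β y) where

  ∑-map-* : ∀ x ys → ∑ g (List.map (j x) ys) ≈ᶜ α x *ᶜ ∑ β ys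
  ∑-map-* x []       = ≈ᶜ.sym (*ᶜ-zeroʳ (α x))
  ∑-map-* x (y ∷ ys) = ≈ᶜ.trans (+ᶜ-cong (g≈αβ x y) (∑-map-* x ys)) (≈ᶜ.sym (*ᶜ-distribˡ (α x) (β y) (∑ β ys)))

  ∑-cartesianProductWith : ∀ xs ys → ∑ g (List.cartesianProductWith j xs ys) ≈ᶜ ∑ α xs *ᶜ ∑ β ys
  ∑-cartesianProductWith []       ys = ≈ᶜ.sym (*ᶜ-zeroˡ (∑ β ys))
  ∑-cartesianProductWith (x ∷ xs) ys =
    ≈ᶜ.trans (∑-++ g (List.map (j x) ys) (List.cartesianProductWith j xs ys))
    (≈ᶜ.trans (+ᶜ-cong (∑-map-* x ys) (∑-cartesianProductWith xs ys))
             (≈ᶜ.sym (*ᶜ-distribʳ (∑ β ys) (α x) (∑ α xs))))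

-- Enumerations of finite sets

module _ {a ℓ} (S : Setoid a ℓ) where

  private module ≈ = Setoid S
  open Membership S using (_∈_)
  open Permutation S using (_↭_; ↭-refl; ↭-sym; ↭-trans; ↭-prep; ↭-reflexive-≋)
  open Unique S using (Unique)

  -- Needed because V(R) and the product of V(R₁) and V(R₂) are listed in unrelated orders and by
  -- different representatives of the same vectors. The head of `xs` is found in `ys` and shifted to
  -- the front; uniqueness keeps it out of both tails, so both inclusions descend to the tails.
  unique∧set⇒↭ : ∀ {xs ys} → Unique xs → Unique ys →
    (∀ {v} → v ∈ xs → v ∈ ys) → (∀ {v} → v ∈ ys → v ∈ xs) → xs ↭ ys
  unique∧set⇒↭ {[]}     {[]}     _ _ _ _ = ↭-refl
  unique∧set⇒↭ {[]}     {y ∷ ys} _ _ _ ⊇ = contradiction (⊇ (here ≈.refl)) λ ()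
  unique∧set⇒↭ {x ∷ xs} {ys}     (x∉xs ∷ xs!) ys! ⊆ ⊇
    with us , vs , w , x≈w , ys≋ ← Membershipₚ.∈-∃++ S (⊆ (here ≈.refl))
    with ys↭ ← ↭-trans (↭-reflexive-≋ ys≋) (Permutationₚ.shift S (≈.sym x≈w) us vs)
    with x∉zs ∷ zs! ← Permutationₚ.Unique-resp-↭ S ys↭ ys!
    = ↭-trans (↭-prep x (unique∧set⇒↭ xs! zs! ⊆′ ⊇′)) (↭-sym ys↭)
    where
    ⊆′ : ∀ {v} → v ∈ xs → v ∈ us ++ vs
    ⊆′ v∈xs with Permutationₚ.∈-resp-↭ S ys↭ (⊆ (there v∈xs))
    ... | here v≈x   = contradiction (Membershipₚ.∈-resp-≈ S v≈x v∈xs) (All¬⇒¬Any x∉xs)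
    ... | there v∈zs = v∈zs
    ⊇′ : ∀ {v} → v ∈ us ++ vs → v ∈ xs
    ⊇′ v∈zs with ⊇ (Permutationₚ.∈-resp-↭ S (↭-sym ys↭) (there v∈zs))
    ... | here v≈x   = contradiction (Membershipₚ.∈-resp-≈ S v≈x v∈zs) (All¬⇒¬Any x∉zs)
    ... | there v∈xs = v∈xs

  ∑-↭ : ∀ {g : ≈.Carrier → ℂ} → (∀ {x y} → x ≈.≈ y → g x ≈ᶜ g y) →
        ∀ {xs ys} → xs ↭ ys → ∑ g xs ≈ᶜ ∑ g ys
  ∑-↭ g-cong xs↭ys = Permutationₚ.foldr-commMonoid ℂ-setoid +ᶜ-isCommutativeMonoid
    (Permutationₚ.map⁺ S ℂ-setoid g-cong xs↭ys)

length-cartesianProductWith : ∀ {a b c} {A : Set a} {B : Set b} {D : Set c} (j : A → B → D) xs ys →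
  List.length (List.cartesianProductWith j xs ys) ≡ List.length xs ℕ.* List.length ys
length-cartesianProductWith j []       ys = refl
length-cartesianProductWith j (x ∷ xs) ys =
  trans (length-++ (List.map (j x) ys))
        (cong₂ ℕ._+_ (length-map (j x) ys) (length-cartesianProductWith j xs ys))

module _ {c ℓ} (R : FiniteRing c ℓ) where

  open FiniteRing R using (order; enumeration; elements; vectors; ≈-setoid)
  private module E = Inverse enumeration

  vecSetoid : ℕ → Setoid c (c ⊔ ℓ)
  vecSetoid = VecEquality.≋-setoid ≈-setoid

  private module ∈ d = Membership (vecSetoid d)

  elements-unique : Unique.Unique ≈-setoid elements
  elements-unique = Uniqueₚ.map⁺ (setoid (Fin order)) ≈-setoid (λ {i} {j} eq →
      trans (sym (E.strictlyInverseʳ i)) (trans (E.from-cong eq) (E.strictlyInverseʳ j)))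
    (UniqueP.allFin⁺ order)

  ∈-elements : ∀ x → Membership._∈_ ≈-setoid x elements
  ∈-elements x = Membershipₚ.∈-resp-≈ ≈-setoid (E.strictlyInverseˡ x)
    (Membershipₚ.∈-map⁺ (setoid (Fin order)) ≈-setoid E.to-cong (Propositional.∈-allFin (E.from x)))

  vectors-unique : ∀ d → Unique.Unique (vecSetoid d) (vectors d)
  vectors-unique zero    = [] ∷ []
  vectors-unique (suc d) = Uniqueₚ.cartesianProductWith⁺ ≈-setoid (vecSetoid d) (vecSetoid (suc d)) _∷_
    (λ { (p ∷ ps) → p , ps }) elements-unique (vectors-unique d)

  ∈-vectors : ∀ {d} x → ∈._∈_ d x (vectors d)
  ∈-vectors []      = here []
  ∈-vectors {suc d} (a ∷ x) = Membershipₚ.∈-cartesianProductWith⁺ ≈-setoid (vecSetoid d) (vecSetoid (suc d))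
    _∷_ (∈-elements a) (∈-vectors x)

  module _ {d} (S : Subset R d) where

    open Subset S

    members-unique : Unique.Unique (vecSetoid d) (members R S)
    members-unique = Uniqueₚ.filter⁺ (vecSetoid d) dec (vectors-unique d)

    ∈-members⁺ : ∀ {x} → member x → ∈._∈_ d x (members R S)
    ∈-members⁺ {x} = Membershipₚ.∈-filter⁺ (vecSetoid d) dec resp (∈-vectors x)

    ∈-members⁻ : ∀ {x} → ∈._∈_ d x (members R S) → member x
    ∈-members⁻ = proj₂ ∘ Membershipₚ.∈-filter⁻ (vecSetoid d) dec resp {xs = vectors d}

-- Ring homomorphisms and the set V

module _ {c ℓ c′ ℓ′} (R : FiniteRing c ℓ) (R′ : FiniteRing c′ ℓ′) where

  private
    module R = FiniteRing R
    module R′ = FiniteRing R′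
    open RawMonoidDefs R.+-rawMonoid using () renaming (_×_ to _×ᴿ_)
    open RawMonoidDefs R′.+-rawMonoid using () renaming (_×_ to _×ᴿ′_)

  IsHomomorphism : (R.Carrier → R′.Carrier) → Set (c ⊔ ℓ ⊔ ℓ′)
  IsHomomorphism = RingMorphisms.IsRingHomomorphism R.rawRing R′.rawRing

  module Homomorphism {φ : R.Carrier → R′.Carrier} (φ-homo : IsHomomorphism φ) where

    open RingMorphisms.IsRingHomomorphism φ-homo public
    open import Relation.Binary.Reasoning.Setoid R′.≈-setoid

    ×-homo : ∀ m a → φ (m ×ᴿ a) R′.≈ m ×ᴿ′ φ a
    ×-homo zero    a = 0#-homo
    ×-homo (suc m) a = R′.trans (+-homo a (m ×ᴿ a)) (R′.+-congˡ (×-homo m a))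

    ·-homo : ∀ m a → φ (m R.· a) R′.≈ m R′.· φ a
    ·-homo (+ m)    a = ×-homo m a
    ·-homo -[1+ m ] a = R′.trans (-‿homo (suc m ×ᴿ a)) (R′.-‿cong (×-homo (suc m) a))

    lookup-map : ∀ {n} (x : Vec R.Carrier n) i → φ (Vec.lookup x i) R′.≈ Vec.lookup (Vec.map φ x) i
    lookup-map (a ∷ x) Fin.zero    = R′.refl
    lookup-map (a ∷ x) (Fin.suc i) = lookup-map x i

    evalWord-homo : ∀ {n} (w : Word n) x → φ (evalWord R w x) R′.≈ evalWord R′ w (Vec.map φ x)
    evalWord-homo []      x = 1#-homo
    evalWord-homo (i ∷ w) x = R′.trans (*-homo _ _) (R′.*-cong (lookup-map x i) (evalWord-homo w x))

    eval-homo : ∀ {n} (f : Polynomial n) x → φ (eval R f x) R′.≈ eval R′ f (Vec.map φ x)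
    eval-homo []            x = 0#-homo
    eval-homo ((m , w) ∷ f) x = R′.trans (+-homo _ _) (R′.+-cong
      (R′.trans (·-homo m _) (Congruence.·-cong R′ m (evalWord-homo w x))) (eval-homo f x))

    last-map : ∀ {n} (x : Vec R.Carrier (suc n)) → φ (Vec.last x) ≡ Vec.last (Vec.map φ x)
    last-map {zero}  (a ∷ []) = refl
    last-map {suc n} (a ∷ x)  = last-map x

    init-map : ∀ {n} (x : Vec R.Carrier (suc n)) → Vec.map φ (Vec.init x) ≡ Vec.init (Vec.map φ x)
    init-map {zero}  (a ∷ []) = refl
    init-map {suc n} (a ∷ x)  = cong (φ a ∷_) (init-map x)

    module _ {n} (f : Polynomial n) (k : ℤ) (x : Vec R.Carrier (suc n)) where

      graph-homo : φ (eval R f (Vec.init x) R.+ k R.· R.1#) R′.≈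
                   eval R′ f (Vec.init (Vec.map φ x)) R′.+ k R′.· R′.1#
      graph-homo = begin
        φ (eval R f (Vec.init x) R.+ k R.· R.1#)
          ≈⟨ +-homo _ _ ⟩
        φ (eval R f (Vec.init x)) R′.+ φ (k R.· R.1#)
          ≈⟨ R′.+-cong (eval-homo f (Vec.init x)) (R′.trans (·-homo k R.1#) (Congruence.·-cong R′ k 1#-homo)) ⟩
        eval R′ f (Vec.map φ (Vec.init x)) R′.+ k R′.· R′.1#
          ≡⟨ cong (λ v → eval R′ f v R′.+ k R′.· R′.1#) (init-map x) ⟩
        eval R′ f (Vec.init (Vec.map φ x)) R′.+ k R′.· R′.1# ∎

      V-homo : Subset.member (V R f k) x → Subset.member (V R′ f k) (Vec.map φ x)
      V-homo h = begin
        Vec.last (Vec.map φ x)                    ≡⟨ last-map x ⟨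
        φ (Vec.last x)                            ≈⟨ ⟦⟧-cong h ⟩
        φ (eval R f (Vec.init x) R.+ k R.· R.1#)  ≈⟨ graph-homo ⟩
        eval R′ f (Vec.init (Vec.map φ x)) R′.+ k R′.· R′.1# ∎

      -- The equation is recovered only after applying `φ`; the two equations obtained from the two
      -- projections of a product together give the one in R.
      V-homo⁻ : Subset.member (V R′ f k) (Vec.map φ x) →
                φ (Vec.last x) R′.≈ φ (eval R f (Vec.init x) R.+ k R.· R.1#)
      V-homo⁻ h = begin
        φ (Vec.last x)                            ≡⟨ last-map x ⟩
        Vec.last (Vec.map φ x)                    ≈⟨ h ⟩
        eval R′ f (Vec.init (Vec.map φ x)) R′.+ k R′.· R′.1# ≈⟨ graph-homo ⟨
        φ (eval R f (Vec.init x) R.+ k R.· R.1#)  ∎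

-- V is a graph, so it has a point above the zero vector. This is what permits division by the
-- cardinality of V.
V-inhabited : ∀ {c ℓ} (R : FiniteRing c ℓ) {n} (f : Polynomial n) k → ∃ (Subset.member (V R f k))
V-inhabited R {n} f k = point , subst₂ (λ a v → a ≈ eval R f v + k · 1#)
  (sym (proj₂ ends)) (sym (proj₁ ends)) (Ring.refl ring)
  where
  open FiniteRing R using (Carrier; _≈_; _+_; _·_; 0#; 1#; ring)
  value = eval R f (Vec.replicate n 0#) + k · 1#
  point = Vec.replicate n 0# Vec.∷ʳ value
  ends-∷ʳ : ∀ {m} (v : Vec Carrier m) a → Vec.init (v Vec.∷ʳ a) ≡ v × Vec.last (v Vec.∷ʳ a) ≡ a
  ends-∷ʳ []      a = refl , refl
  ends-∷ʳ (b ∷ v) a = let p , q = ends-∷ʳ v a in cong (b ∷_) p , q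
  ends = ends-∷ʳ (Vec.replicate n 0#) value

card-V-positive : ∀ {c ℓ} (R : FiniteRing c ℓ) {n} (f : Polynomial n) k → ℕ.NonZero (card R (V R f k))
card-V-positive R f k with members R (V R f k) | ∈-members⁺ R (V R f k) (proj₂ (V-inhabited R f k))
... | _ ∷ _ | _ = _

-- Factorisations of rings

-- ProductDecomposition with the isomorphism given by its components, so that
-- the two factors can be interchanged.
record Factorisation {c ℓ c₁ ℓ₁ c₂ ℓ₂}
  (R : FiniteRing c ℓ) (R₁ : FiniteRing c₁ ℓ₁) (R₂ : FiniteRing c₂ ℓ₂) :
  Set (c ⊔ ℓ ⊔ c₁ ⊔ ℓ₁ ⊔ c₂ ⊔ ℓ₂) where
  private
    module R  = FiniteRing R
    module R₁ = FiniteRing R₁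
    module R₂ = FiniteRing R₂
  field
    π₁        : R.Carrier → R₁.Carrier
    π₂        : R.Carrier → R₂.Carrier
    π₁-homo   : IsHomomorphism R R₁ π₁
    π₂-homo   : IsHomomorphism R R₂ π₂
    pair      : R₁.Carrier → R₂.Carrier → R.Carrier
    π₁-pair   : ∀ a b → π₁ (pair a b) R₁.≈ a
    π₂-pair   : ∀ a b → π₂ (pair a b) R₂.≈ b
    injective : ∀ {x y} → π₁ x R₁.≈ π₁ y → π₂ x R₂.≈ π₂ y → x R.≈ y

module _ {c ℓ c₁ ℓ₁ c₂ ℓ₂}
  {R : FiniteRing c ℓ} {R₁ : FiniteRing c₁ ℓ₁} {R₂ : FiniteRing c₂ ℓ₂} where

  private
    module R  = FiniteRing R
    module R₁ = FiniteRing R₁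
    module R₂ = FiniteRing R₂

  factorisation : ProductDecomposition R R₁ R₂ → Factorisation R R₁ R₂
  factorisation D = record
    { π₁ = proj₁ ∘ split
    ; π₂ = proj₂ ∘ split
    ; π₁-homo = record
      { isSemiringHomomorphism = record
        { isNearSemiringHomomorphism = record
          { +-isMonoidHomomorphism = record
            { isMagmaHomomorphism = record
              { isRelHomomorphism = record { cong = proj₁ ∘ ⟦⟧-cong }
              ; homo = λ x y → proj₁ (+-homo x y) }
            ; ε-homo = proj₁ 0#-homo }
          ; *-homo = λ x y → proj₁ (*-homo x y) }
        ; 1#-homo = proj₁ 1#-homo }
      ; -‿homo = λ x → proj₁ (-‿homo x) }
    ; π₂-homo = record
      { isSemiringHomomorphism = record
        { isNearSemiringHomomorphism = record
          { +-isMonoidHomomorphism = record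
            { isMagmaHomomorphism = record
              { isRelHomomorphism = record { cong = proj₂ ∘ ⟦⟧-cong }
              ; homo = λ x y → proj₂ (+-homo x y) }
            ; ε-homo = proj₂ 0#-homo }
          ; *-homo = λ x y → proj₂ (*-homo x y) }
        ; 1#-homo = proj₂ 1#-homo }
      ; -‿homo = λ x → proj₂ (-‿homo x) }
    ; pair = λ a b → proj₁ (surjective (a , b))
    ; π₁-pair = λ a b → proj₁ (proj₂ (surjective (a , b)) R.refl)
    ; π₂-pair = λ a b → proj₂ (proj₂ (surjective (a , b)) R.refl)
    ; injective = λ p q → injective (p , q)
    }
    where
    open ProductDecomposition D
    open RingMorphisms.IsRingIsomorphism isRingIsomorphism

  swap : Factorisation R R₁ R₂ → Factorisation R R₂ R₁
  swap F = record
    { π₁ = π₂ ; π₂ = π₁ ; π₁-homo = π₂-homo ; π₂-homo = π₁-homo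
    ; pair = λ b a → pair a b
    ; π₁-pair = λ b a → π₂-pair a b
    ; π₂-pair = λ b a → π₁-pair a b
    ; injective = λ p q → injective q p }
    where open Factorisation F

  module FactorisationProperties (F : Factorisation R R₁ R₂) where

    open Factorisation F
    private
      module π₁ = Homomorphism R R₁ π₁-homo
      module π₂ = Homomorphism R R₂ π₂-homo
      module ≋ {d} = Setoid (vecSetoid R d)
      module ≋₁ {d} = Setoid (vecSetoid R₁ d)
      module ≋₂ {d} = Setoid (vecSetoid R₂ d)

    -- Together with `Vec.map π₁` and `Vec.map π₂`, this is the identification of R^d with the
    -- product of R₁^d and R₂^d.
    zip : ∀ {d} → Vec R₁.Carrier d → Vec R₂.Carrier d → Vec R.Carrier d
    zip = Vec.zipWith pair

    0₁ : ∀ {d} → Vec R₁.Carrier d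
    0₁ {d} = Vec.replicate d R₁.0#

    0₂ : ∀ {d} → Vec R₂.Carrier d
    0₂ {d} = Vec.replicate d R₂.0#

    -- Surjectivity supplies `pair` as a mere choice of preimages. That the choice respects
    -- equality, and likewise addition, is seen by comparing both projections.
    pair-cong : ∀ {a a′ b b′} → a R₁.≈ a′ → b R₂.≈ b′ → pair a b R.≈ pair a′ b′
    pair-cong p q = injective
      (R₁.trans (π₁-pair _ _) (R₁.trans p (R₁.sym (π₁-pair _ _))))
      (R₂.trans (π₂-pair _ _) (R₂.trans q (R₂.sym (π₂-pair _ _))))

    pair-+ : ∀ a a′ b b′ → pair (a R₁.+ a′) (b R₂.+ b′) R.≈ pair a b R.+ pair a′ b′
    pair-+ a a′ b b′ = injective
      (R₁.trans (π₁-pair _ _) (R₁.sym (R₁.trans (π₁.+-homo _ _) (R₁.+-cong (π₁-pair _ _) (π₁-pair _ _)))))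
      (R₂.trans (π₂-pair _ _) (R₂.sym (R₂.trans (π₂.+-homo _ _) (R₂.+-cong (π₂-pair _ _) (π₂-pair _ _)))))

    zip-cong : ∀ {d} {x x′ : Vec R₁.Carrier d} {y y′ : Vec R₂.Carrier d} →
      x R₁.≋ x′ → y R₂.≋ y′ → zip x y R.≋ zip x′ y′
    zip-cong []       []       = []
    zip-cong (p ∷ ps) (q ∷ qs) = pair-cong p q ∷ zip-cong ps qs

    zip-⊕ : ∀ {d} (x x′ : Vec R₁.Carrier d) (y y′ : Vec R₂.Carrier d) →
      zip (x R₁.⊕ x′) (y R₂.⊕ y′) R.≋ zip x y R.⊕ zip x′ y′
    zip-⊕ []      []        []      []        = []
    zip-⊕ (a ∷ x) (a′ ∷ x′) (b ∷ y) (b′ ∷ y′) = pair-+ a a′ b b′ ∷ zip-⊕ x x′ y y′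

    map-π₁-zip : ∀ {d} (x : Vec R₁.Carrier d) (y : Vec R₂.Carrier d) → Vec.map π₁ (zip x y) R₁.≋ x
    map-π₁-zip []      []      = []
    map-π₁-zip (a ∷ x) (b ∷ y) = π₁-pair a b ∷ map-π₁-zip x y

    map-π₂-zip : ∀ {d} (x : Vec R₁.Carrier d) (y : Vec R₂.Carrier d) → Vec.map π₂ (zip x y) R₂.≋ y
    map-π₂-zip []      []      = []
    map-π₂-zip (a ∷ x) (b ∷ y) = π₂-pair a b ∷ map-π₂-zip x y

    zip-map-π : ∀ {d} (x : Vec R.Carrier d) → x R.≋ zip (Vec.map π₁ x) (Vec.map π₂ x)
    zip-map-π []      = []
    zip-map-π (a ∷ x) = injective (R₁.sym (π₁-pair _ _)) (R₂.sym (π₂-pair _ _)) ∷ zip-map-π x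

    map-π₁-cong : ∀ {d} {x x′ : Vec R.Carrier d} → x R.≋ x′ → Vec.map π₁ x R₁.≋ Vec.map π₁ x′
    map-π₁-cong []       = []
    map-π₁-cong (p ∷ ps) = π₁.⟦⟧-cong p ∷ map-π₁-cong ps

    map-π₂-cong : ∀ {d} {x x′ : Vec R.Carrier d} → x R.≋ x′ → Vec.map π₂ x R₂.≋ Vec.map π₂ x′
    map-π₂-cong []       = []
    map-π₂-cong (p ∷ ps) = π₂.⟦⟧-cong p ∷ map-π₂-cong ps

    map-π₁-⊕ : ∀ {d} (x y : Vec R.Carrier d) → Vec.map π₁ (x R.⊕ y) R₁.≋ Vec.map π₁ x R₁.⊕ Vec.map π₁ y
    map-π₁-⊕ []      []      = []
    map-π₁-⊕ (a ∷ x) (b ∷ y) = π₁.+-homo a b ∷ map-π₁-⊕ x y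

    zip-injective : ∀ {d} {x x′ : Vec R₁.Carrier d} {y y′ : Vec R₂.Carrier d} →
      zip x y R.≋ zip x′ y′ → x R₁.≋ x′ × y R₂.≋ y′
    zip-injective p =
        ≋₁.trans (≋₁.sym (map-π₁-zip _ _)) (≋₁.trans (map-π₁-cong p) (map-π₁-zip _ _))
      , ≋₂.trans (≋₂.sym (map-π₂-zip _ _)) (≋₂.trans (map-π₂-cong p) (map-π₂-zip _ _))

    -- Characters of a product

    open Character

    -- Pullback along x ↦ (x, 0). This map preserves addition but not 1, so its additivity comes
    -- from `zip-⊕` and 0 + 0 = 0.
    restrict : ∀ {d} → Character R d → Character R₁ d
    restrict ψ .χ x         = χ ψ (zip x 0₂)
    restrict ψ .χ-cong p    = χ-cong ψ (zip-cong p ≋₂.refl)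
    restrict ψ .χ-modulus x = χ-modulus ψ (zip x 0₂)
    restrict ψ .χ-homo x y  = ≈ᶜ.trans
      (χ-cong ψ (≋.trans (zip-cong ≋₁.refl (≋₂.sym 0⊕0)) (zip-⊕ x y 0₂ 0₂)))
      (χ-homo ψ (zip x 0₂) (zip y 0₂))
      where
      0⊕0 : ∀ {d} → 0₂ {d} R₂.⊕ 0₂ R₂.≋ 0₂ {d}
      0⊕0 {zero}  = []
      0⊕0 {suc d} = R₂.+-identityˡ R₂.0# ∷ 0⊕0

    -- Pullback along the first projection: the character that is ψ on the first factor and 1 on the
    -- second.
    inflate : ∀ {d} → Character R₁ d → Character R d
    inflate ψ .χ x         = χ ψ (Vec.map π₁ x)
    inflate ψ .χ-cong p    = χ-cong ψ (map-π₁-cong p)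
    inflate ψ .χ-modulus x = χ-modulus ψ (Vec.map π₁ x)
    inflate ψ .χ-homo x y  = ≈ᶜ.trans (χ-cong ψ (map-π₁-⊕ x y)) (χ-homo ψ _ _)

    -- Every x lifts to (x, 0), so an inflated character that is identically 1 comes from one that
    -- is identically 1.
    inflate-nontrivial : ∀ {d} (ψ : Character R₁ d) → Nontrivial R₁ ψ → Nontrivial R (inflate ψ)
    inflate-nontrivial ψ ψ≉1 h = ψ≉1 λ x →
      ≈ᶜ.trans (χ-cong ψ (≋₁.sym (map-π₁-zip x 0₂))) (h (zip x 0₂))

    -- The decomposition (x, y) = (x, 0) + (0, y) and the homomorphism property.
    χ-zip : ∀ {d} (ψ : Character R d) x y → χ ψ (zip x y) ≈ᶜ χ ψ (zip x 0₂) *ᶜ χ ψ (zip 0₁ y)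
    χ-zip ψ x y = ≈ᶜ.trans
      (χ-cong ψ (≋.trans (zip-cong (≋₁.sym (x⊕0 x)) (≋₂.sym (0⊕y y))) (zip-⊕ x 0₁ 0₂ y)))
      (χ-homo ψ (zip x 0₂) (zip 0₁ y))
      where
      x⊕0 : ∀ {d} (x : Vec R₁.Carrier d) → x R₁.⊕ 0₁ R₁.≋ x
      x⊕0 []      = []
      x⊕0 (a ∷ x) = R₁.+-identityʳ a ∷ x⊕0 x
      0⊕y : ∀ {d} (y : Vec R₂.Carrier d) → 0₂ R₂.⊕ y R₂.≋ y
      0⊕y []      = []
      0⊕y (b ∷ y) = R₂.+-identityˡ b ∷ 0⊕y y

    -- The set V of a product

    module _ {n} (f : Polynomial n) (k : ℤ) where

      private
        V₀ = V R f k
        V₁ = V R₁ f k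
        V₂ = V R₂ f k
        module S  = Subset V₀
        module S₁ = Subset V₁
        module S₂ = Subset V₂

      zip-V : ∀ {x y} → S₁.member x → S₂.member y → S.member (zip x y)
      zip-V {x} {y} p q = injective
        (π₁.V-homo⁻ f k (zip x y) (S₁.resp (≋₁.sym (map-π₁-zip x y)) p))
        (π₂.V-homo⁻ f k (zip x y) (S₂.resp (≋₂.sym (map-π₂-zip x y)) q))

      open Permutation (vecSetoid R (suc n)) using (_↭_)

      -- Ring homomorphisms commute with polynomials over the integers, so the equation defining V
      -- holds in R exactly when its two projections hold. Both lists are free of repetitions and
      -- hence agree up to order.
      members-V-↭ : members R V₀ ↭ List.cartesianProductWith zip (members R₁ V₁) (members R₂ V₂)
      members-V-↭ = unique∧set⇒↭ sR (members-unique R V₀)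
        (Uniqueₚ.cartesianProductWith⁺ sR₁ sR₂ sR zip zip-injective (members-unique R₁ V₁) (members-unique R₂ V₂))
        (λ {x} x∈ → let h = ∈-members⁻ R V₀ x∈ in
          Membershipₚ.∈-resp-≈ sR (≋.sym (zip-map-π x))
            (Membershipₚ.∈-cartesianProductWith⁺ sR₁ sR₂ sR zip-cong
              (∈-members⁺ R₁ V₁ (π₁.V-homo f k x h)) (∈-members⁺ R₂ V₂ (π₂.V-homo f k x h))))
        (λ z∈ → let x , y , x∈ , y∈ , z≋ = Membershipₚ.∈-cartesianProductWith⁻ sR₁ sR₂ sR zip
                                             (members R₁ V₁) (members R₂ V₂) z∈ in
          ∈-members⁺ R V₀ (S.resp (≋.sym z≋) (zip-V (∈-members⁻ R₁ V₁ x∈) (∈-members⁻ R₂ V₂ y∈))))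
        where
        sR  = vecSetoid R (suc n)
        sR₁ = vecSetoid R₁ (suc n)
        sR₂ = vecSetoid R₂ (suc n)

      card-V-* : card R V₀ ≡ card R₁ V₁ ℕ.* card R₂ V₂
      card-V-* = trans (Permutationₚ.xs↭ys⇒|xs|≡|ys| (vecSetoid R (suc n)) members-V-↭)
        (length-cartesianProductWith zip (members R₁ V₁) (members R₂ V₂))

      -- `α` and `β` are arbitrary functions in order to cover both uses: the two restrictions of a
      -- character of R, and a character of R₁ paired with the constant 1.
      ∑-V-* : (ψ : Character R (suc n)) (α : Vec R₁.Carrier (suc n) → ℂ) (β : Vec R₂.Carrier (suc n) → ℂ) →
        (∀ x y → χ ψ (zip x y) ≈ᶜ α x *ᶜ β y) →
        ∑ (χ ψ) (members R V₀) ≈ᶜ ∑ α (members R₁ V₁) *ᶜ ∑ β (members R₂ V₂)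
      ∑-V-* ψ α β h = ≈ᶜ.trans (∑-↭ (vecSetoid R (suc n)) (χ-cong ψ) members-V-↭)
        (∑-cartesianProductWith zip (χ ψ) α β h (members R₁ V₁) (members R₂ V₂))

-- Salem numbers

module _ {c ℓ} (R : FiniteRing c ℓ) {d} (S : Subset R d) where

  open Character

  -- The Salem condition freed of the order of the ring, so that the conditions for R, R₁ and R₂ can
  -- be compared directly.
  HasSumBound : ℝ → Set (c ⊔ ℓ)
  HasSumBound C = (ψ : Character R d) → Nontrivial R ψ →
    ∣ ∑ (χ ψ) (members R S) ∣ᶜ ≤ᴿ C *ᴿ √ (fromℕ (card R S))

  private
    instance
      order^d≢0 : ℕ.NonZero (FiniteRing.order R ℕ.^ d)
      order^d≢0 = ℕ.m^n≢0 (FiniteRing.order R) d {{FiniteRing.order-nonZero R}}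

    -- `fromℚ q` is `order⁻ R d` by definition; having it as a rational makes it cancellable.
    q : ℚ
    q = + 1 ℚ./ (FiniteRing.order R ℕ.^ d)

    q-positive : ℚ.Positive q
    q-positive = ℚ.normalize-pos 1 (FiniteRing.order R ℕ.^ d)

    q-nonNeg : NonNeg (fromℚ q)
    q-nonNeg _ = ℚ.<⇒≤ (ℚ.positive⁻¹ q {{q-positive}})

    abs-fourier : ∀ ψ → ∣ fourier R S ψ ∣ᶜ ≈ᴿ fromℚ q *ᴿ ∣ ∑ (χ ψ) (members R S) ∣ᶜ
    abs-fourier ψ = ≈-trans (abs-* (fromℝ (fromℚ q)) (∑ (χ ψ) (members R S)))
      (*-cong (abs-fromℝ (fromℚ q) q-nonNeg) ≈-refl)

    bound-comm : ∀ C s → C *ᴿ fromℚ q *ᴿ s ≈ᴿ fromℚ q *ᴿ (C *ᴿ s)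
    bound-comm C s = pointwise-≈ λ n →
      solve 3 (λ C q s → C :* q :* s := q :* (C :* s)) refl (seq C n) q (seq s n)

  salem⇒sumBound : ∀ {C} → IsSalem R C S → HasSumBound C
  salem⇒sumBound {C} h ψ ψ≉1 = *-cancelˡ-≤ q {{q-positive}} (begin
    fromℚ q *ᴿ ∣ ∑ (χ ψ) (members R S) ∣ᶜ        ≈⟨ abs-fourier ψ ⟨
    ∣ fourier R S ψ ∣ᶜ                           ≤⟨ h ψ ψ≉1 ⟩
    C *ᴿ fromℚ q *ᴿ √ (fromℕ (card R S))         ≈⟨ bound-comm C (√ (fromℕ (card R S))) ⟩
    fromℚ q *ᴿ (C *ᴿ √ (fromℕ (card R S)))       ∎)
    where open ≤ᴿ-Reasoning

  sumBound⇒salem : ∀ {C} → HasSumBound C → IsSalem R C S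
  sumBound⇒salem {C} h ψ ψ≉1 = begin
    ∣ fourier R S ψ ∣ᶜ                           ≈⟨ abs-fourier ψ ⟩
    fromℚ q *ᴿ ∣ ∑ (χ ψ) (members R S) ∣ᶜ        ≤⟨ *-monoˡ-≤ q-nonNeg (h ψ ψ≉1) ⟩
    fromℚ q *ᴿ (C *ᴿ √ (fromℕ (card R S)))       ≈⟨ bound-comm C (√ (fromℕ (card R S))) ⟨
    C *ᴿ fromℚ q *ᴿ √ (fromℕ (card R S))         ∎
    where open ≤ᴿ-Reasoning

  sumBound-mono : ∀ {C C′} → C ≤ᴿ C′ → HasSumBound C → HasSumBound C′
  sumBound-mono C≤C′ h ψ ψ≉1 = ≤-trans (h ψ ψ≉1) (*-monoʳ-≤ (√-nonNeg (fromℕ (card R S))) C≤C′)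

module _ {c ℓ c₁ ℓ₁ c₂ ℓ₂}
  {R : FiniteRing c ℓ} {R₁ : FiniteRing c₁ ℓ₁} {R₂ : FiniteRing c₂ ℓ₂}
  (F : Factorisation R R₁ R₂) {n} (f : Polynomial n) (k : ℤ) where

  open FactorisationProperties F
  open Character

  private
    V₀ = V R f k
    V₁ = V R₁ f k
    V₂ = V R₂ f k
    m₁ = fromℕ (card R₁ V₁)
    m₂ = fromℕ (card R₂ V₂)
    0≤m₂ = fromℕ-nonNeg (card R₂ V₂)

    √m₂²≈m₂ : √ m₂ *ᴿ √ m₂ ≈ᴿ m₂
    √m₂²≈m₂ = √-square 0≤m₂

  √card-V-* : √ (fromℕ (card R V₀)) ≈ᴿ √ m₁ *ᴿ √ m₂
  √card-V-* = begin
    √ (fromℕ (card R V₀))                      ≡⟨ cong (λ m → √ (fromℕ m)) (card-V-* f k) ⟩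
    √ (fromℕ (card R₁ V₁ ℕ.* card R₂ V₂))      ≈⟨ √-cong (fromℕ-nonNeg (card R₁ V₁ ℕ.* card R₂ V₂))
                                                    (*-nonNeg {m₁} {m₂} (fromℕ-nonNeg (card R₁ V₁)) 0≤m₂)
                                                    (fromℕ-* (card R₁ V₁) (card R₂ V₂)) ⟩
    √ (m₁ *ᴿ m₂)                               ≈⟨ √-* {m₁} {m₂} (fromℕ-nonNeg (card R₁ V₁)) 0≤m₂ ⟩
    √ m₁ *ᴿ √ m₂                               ∎
    where open import Relation.Binary.Reasoning.Setoid (Poset.Eq.setoid ≤-poset)

  restrict-bound : ∀ {C} → HasSumBound R₁ V₁ C → ∀ ψ → Nontrivial R₁ (restrict ψ) →
    ∣ ∑ (χ ψ) (members R V₀) ∣ᶜ ≤ᴿ (C *ᴿ √ m₂) *ᴿ √ (fromℕ (card R V₀))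
  restrict-bound {C} h ψ ψ₁≉1 = begin
    ∣ ∑ (χ ψ) (members R V₀) ∣ᶜ   ≈⟨ abs-cong (∑-V-* f k ψ (χ (restrict ψ)) β (χ-zip ψ)) ⟩
    ∣ s₁ *ᶜ s₂ ∣ᶜ                 ≈⟨ abs-* s₁ s₂ ⟩
    -- The second factor is estimated before the first, so that the multipliers are `∣ s₁ ∣ᶜ` and
    -- then `m₂`, both termwise nonnegative; the sign of C does not enter.
    ∣ s₁ ∣ᶜ *ᴿ ∣ s₂ ∣ᶜ            ≤⟨ *-monoˡ-≤ (abs-nonNeg s₁) (abs-∑-≤ β (λ y → χ-modulus ψ (zip 0₁ y)) (members R₂ V₂)) ⟩
    ∣ s₁ ∣ᶜ *ᴿ m₂                 ≤⟨ *-monoʳ-≤ 0≤m₂ (h (restrict ψ) ψ₁≉1) ⟩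
    -- One root of `m₂` goes to the constant, the other joins `√ m₁` to form the root of the
    -- cardinality of V(R).
    (C *ᴿ √ m₁) *ᴿ m₂             ≈⟨ *-congˡ √m₂²≈m₂ ⟨
    (C *ᴿ √ m₁) *ᴿ (√ m₂ *ᴿ √ m₂) ≈⟨ pointwise-≈ (λ i → solve 3 (λ C r s → (C :* r) :* (s :* s) := (C :* s) :* (r :* s)) refl
                                       (seq C i) (seq (√ m₁) i) (seq (√ m₂) i)) ⟩
    (C *ᴿ √ m₂) *ᴿ (√ m₁ *ᴿ √ m₂) ≈⟨ *-congˡ √card-V-* ⟨
    (C *ᴿ √ m₂) *ᴿ √ (fromℕ (card R V₀)) ∎
    where
    open ≤ᴿ-Reasoning
    β = λ y → χ ψ (zip 0₁ y)
    s₁ = ∑ (χ (restrict ψ)) (members R₁ V₁)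
    s₂ = ∑ β (members R₂ V₂)

  -- Characters pulled back from R₁ show that C / √m₂ = C √m₂ / m₂ bounds the sums over V₁.
  salemNumber-lower : ∀ {C C₁} → HasSumBound R V₀ C → (∀ C′ → HasSumBound R₁ V₁ C′ → C₁ ≤ᴿ C′) →
    C₁ *ᴿ √ m₂ ≤ᴿ C
  salemNumber-lower {C} {C₁} h C₁-least = begin
    C₁ *ᴿ √ m₂                      ≤⟨ *-monoʳ-≤ (√-nonNeg m₂) (C₁-least C′ C′-bound) ⟩
    C′ *ᴿ √ m₂                      ≈⟨ pointwise-≈ (λ i → solve 3 (λ r C s → r :* (C :* s) :* s := r :* (C :* (s :* s))) refl
                                         (ℚ.1/ q) (seq C i) (seq (√ m₂) i)) ⟩
    r *ᴿ (C *ᴿ (√ m₂ *ᴿ √ m₂))      ≈⟨ *-congˡ (≈-trans (*-congˡ √m₂²≈m₂) (*-comm C m₂)) ⟩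
    r *ᴿ (m₂ *ᴿ C)                  ≈⟨ pointwise-≈ (λ i → 1/-cancelˡ q (seq C i)) ⟩
    C                               ∎
    where
    open ≤ᴿ-Reasoning
    q : ℚ
    q = + card R₂ V₂ ℚ./ 1
    instance
      q-positive : ℚ.Positive q
      q-positive = ℚ.normalize-pos (card R₂ V₂) 1 {{_}} {{card-V-positive R₂ f k}}
      q≢0 : ℚ.NonZero q
      q≢0 = ℚ.pos⇒nonZero q
    r = fromℚ (ℚ.1/ q)
    C′ = r *ᴿ (C *ᴿ √ m₂)
    C′-bound : HasSumBound R₁ V₁ C′
    C′-bound ψ ψ≉1 = *-cancelˡ-≤ q (begin
      m₂ *ᴿ ∣ s₁ ∣ᶜ                          ≈⟨ *-comm m₂ ∣ s₁ ∣ᶜ ⟩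
      -- Reading `m₂` as the modulus of the sum of 1 over V(R₂) turns the product into the sum of
      -- the inflated character over V(R).
      ∣ s₁ ∣ᶜ *ᴿ m₂                          ≈⟨ *-congˡ (abs-fromℝ m₂ 0≤m₂) ⟨
      ∣ s₁ ∣ᶜ *ᴿ ∣ fromℝ m₂ ∣ᶜ               ≈⟨ abs-* s₁ (fromℝ m₂) ⟨
      ∣ s₁ *ᶜ fromℝ m₂ ∣ᶜ                    ≈⟨ abs-cong (*ᶜ-cong (≈ᶜ.refl {s₁}) (∑-1 (members R₂ V₂))) ⟨
      ∣ s₁ *ᶜ ∑ (λ _ → 1ᶜ) (members R₂ V₂) ∣ᶜ ≈⟨ abs-cong (∑-V-* f k (inflate ψ) (χ ψ) (λ _ → 1ᶜ) (λ x y →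
                                                  ≈ᶜ.trans (χ-cong ψ (map-π₁-zip x y)) (≈ᶜ.sym (*ᶜ-identityʳ (χ ψ x))))) ⟨
      ∣ ∑ (χ (inflate ψ)) (members R V₀) ∣ᶜ  ≤⟨ h (inflate ψ) (inflate-nontrivial ψ ψ≉1) ⟩
      C *ᴿ √ (fromℕ (card R V₀))             ≈⟨ *-congˡ √card-V-* ⟩
      C *ᴿ (√ m₁ *ᴿ √ m₂)                    ≈⟨ pointwise-≈ (λ i → 1/-cancelˡ q (seq C i ℚ.* (seq (√ m₁) i ℚ.* seq (√ m₂) i))) ⟨
      r *ᴿ (m₂ *ᴿ (C *ᴿ (√ m₁ *ᴿ √ m₂)))     ≈⟨ pointwise-≈ (λ i → solve 5 (λ r m C s t → r :* (m :* (C :* (s :* t))) := m :* ((r :* (C :* t)) :* s)) refl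
                                                  (ℚ.1/ q) q (seq C i) (seq (√ m₁) i) (seq (√ m₂) i)) ⟩
      m₂ *ᴿ (C′ *ᴿ √ m₁)                     ∎)
      where s₁ = ∑ (χ ψ) (members R₁ V₁)

-- The product formula

module _ {c ℓ c₁ ℓ₁ c₂ ℓ₂}
  {R : FiniteRing c ℓ} {R₁ : FiniteRing c₁ ℓ₁} {R₂ : FiniteRing c₂ ℓ₂}
  (F : Factorisation R R₁ R₂) where

  private
    module F₁ = FactorisationProperties F
    module F₂ = FactorisationProperties (swap F)

  -- The doubly negated form of "one of the restrictions is nontrivial". Since the goal is
  -- absurdity, both doubly negated trivialities may be opened, and then `χ-zip` makes ψ trivial.
  restrictions-nontrivial : ∀ {d} (ψ : Character R d) → Nontrivial R ψ →
    ¬ (¬ Nontrivial R₁ (F₁.restrict ψ) × ¬ Nontrivial R₂ (F₂.restrict ψ))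
  restrictions-nontrivial ψ ψ≉1 (t₁ , t₂) = t₁ λ ψ₁≈1 → t₂ λ ψ₂≈1 → ψ≉1 λ x → ≈ᶜ.trans
    (χ-cong ψ (F₁.zip-map-π x))
    -- `F₂` zips its arguments in the opposite order, so its restriction is evaluated at a vector
    -- that agrees with the one in `F₁.χ-zip` only after commuting `zipWith`.
    (≈ᶜ.trans (F₁.χ-zip ψ _ _) (≈ᶜ.trans (*ᶜ-cong (ψ₁≈1 _) (subst (λ v → χ ψ v ≈ᶜ 1ᶜ) (zipWith-comm (λ _ _ → refl) _ _) (ψ₂≈1 _))) (*ᶜ-identityʳ 1ᶜ)))
    where open Character

-- The equivalence says both that a Salem number of R must equal the maximum and that the maximum is
-- one, so existence for R follows from existence for the factors. Both directions rest on `M-bound`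
-- and `M-least`.
lemma2p22 : ∀ {c ℓ c₁ ℓ₁ c₂ ℓ₂} (n : ℕ) → 2 ≤ suc n →
    (f : Polynomial n) → constantTerm f ≡ 0ℤ → (k : ℤ) →
    (R : FiniteRing c ℓ) (R₁ : FiniteRing c₁ ℓ₁) (R₂ : FiniteRing c₂ ℓ₂) →
    ProductDecomposition R R₁ R₂ →
    (C₁ C₂ : ℝ) → IsSalemNumber R₁ f k C₁ → IsSalemNumber R₂ f k C₂ →
    (C : ℝ) → IsSalemNumber R f k C ⇔
    (C ≈ᴿ (C₁ *ᴿ √ (fromℕ (card R₂ (V R₂ f k)))) ⊔ᴿ (C₂ *ᴿ √ (fromℕ (card R₁ (V R₁ f k)))))
lemma2p22 n _ f _ k R R₁ R₂ D C₁ C₂ (salem₁ , least₁) (salem₂ , least₂) C = mk⇔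
  (λ (salem , least) → ≤-antisym (least M (sumBound⇒salem R V₀ M-bound)) (M-least (salem⇒sumBound R V₀ salem)))
  (λ C≈M → sumBound⇒salem R V₀ (sumBound-mono R V₀ (≈⇒≤ (≈-sym C≈M)) M-bound)
         , λ C′ salem → ≤-trans (≈⇒≤ C≈M) (M-least (salem⇒sumBound R V₀ salem)))
  where
  F = factorisation D
  V₀ = V R f k
  V₁ = V R₁ f k
  V₂ = V R₂ f k
  M₁ = C₁ *ᴿ √ (fromℕ (card R₂ V₂))
  M₂ = C₂ *ᴿ √ (fromℕ (card R₁ V₁))
  M = M₁ ⊔ᴿ M₂
  0≤√m = √-nonNeg (fromℕ (card R V₀))

  M-bound : HasSumBound R V₀ M
  -- By stability the bound may be assumed false; it then suffices that nontriviality of either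
  -- restriction would give it.
  M-bound ψ ψ≉1 = ≤-stable λ ¬bound → restrictions-nontrivial F ψ ψ≉1
    ( (λ ψ₁≉1 → ¬bound (≤-trans (restrict-bound F f k (salem⇒sumBound R₁ V₁ salem₁) ψ ψ₁≉1)
                                (*-monoʳ-≤ 0≤√m (x≤x⊔y M₁ M₂))))
    , (λ ψ₂≉1 → ¬bound (≤-trans (restrict-bound (swap F) f k (salem⇒sumBound R₂ V₂ salem₂) ψ ψ₂≉1)
                                (*-monoʳ-≤ 0≤√m (y≤x⊔y M₁ M₂)))))

  M-least : ∀ {C′} → HasSumBound R V₀ C′ → M ≤ᴿ C′
  M-least h = ⊔-lub
    (salemNumber-lower F f k h λ C′ b → least₁ C′ (sumBound⇒salem R₁ V₁ b))
    (salemNumber-lower (swap F) f k h λ C′ b → least₂ C′ (sumBound⇒salem R₂ V₂ b))
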